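{- For each nonnegative integer $k$, the map $\pi\mapsto\mathrm{DL}_k(\mathrm{swd}(\pi))$ restricted to $\mathcal U_{2k+1}(132,312)$ is a bijection from $\mathcal U_{2k+1}(132,312)$ to $\mathrm{Int}(\mathcal A_k)=\{(\Lambda,\Lambda):\Lambda\in\mathbf D_k\}$. Hence $|\mathcal U_{2k+1}(132,312)|=C_k=\frac{1}{k+1}\binom{2k}{k}$.
   Context: Permutations are finite words of distinct positive integers; $S_n$ is the set of permutations of $[n]$. The stack-sorting map $s$: $s(\text{empty})=\text{empty}$, and if $\pi=LnR$ with $n$ the largest entry, $s(\pi)=s(L)s(R)n$. $\pi$ is uniquely sorted if it has exactly one preimage under $s$. A permutation avoids $\tau$ if no subsequence has the same relative order as $\tau$; $\mathcal U_n(\tau^{(1)},\dots)$ is the set of uniquely sorted permutations in $S_n$ avoiding the listed patterns. A descent of $\pi$ is an index $i$ with $\pi_i>\pi_{i+1}$; $\mathrm{Des}(\pi)$ is the set of descents. $\mathrm{rev}$ reverses a word, $\mathrm{rot}(\pi)=\mathrm{rev}(\pi^{ -1})$ with $\pi^{ -1}$ the group inverse. Sliding operators: for $\pi\in S_n$, $i\in[n]$, let $L_i$ (resp. $R_i$) be the set of elements of $[i-1]$ to the left (resp. right) of the entry $i$ in $\pi$. $\mathrm{swu}_i(\pi)$ has $j$-th entry $\pi_j$ if $\pi_j\ge i$, $m$ if $\pi_j$ is the $m$-th smallest element of $R_i$, and $i-m$ if $\pi_j$ is the $m$-th largest element of $L_i$. $\mathrm{swd}_i=\mathrm{rev}\circ\mathrm{swu}_i\circ\mathrm{rev}$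 and $\mathrm{swd}=\mathrm{swd}_1\circ\cdots\circ\mathrm{swd}_n$ on $S_n$. $\mathbf D_k$ is the set of Dyck paths of semilength $k$ (words in $\{U,D\}$ with $k$ of each letter, every prefix having at least as many $U$'s as $D$'s); $\mathcal A_k$ is the antichain on $\mathbf D_k$; $\mathrm{Int}(P)$ is the set of pairs $(x,y)$ with $x\le y$ in $P$. For $\pi\in\mathcal U_{2k+1}(312)$, $n=2k+1$, let $\Lambda_i=D$ if $n-i\in\mathrm{Des}(\pi)$ and $U$ otherwise, $\Lambda'_i=U$ if $i\in\mathrm{Des}(\mathrm{rot}(\pi))$ and $D$ otherwise ($1\le i\le 2k$), and $\mathrm{DL}_k(\pi)=(\Lambda_1\cdots\Lambda_{2k},\Lambda'_1\cdots\Lambda'_{2k})$. -}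

module Defs where

open import Data.Nat using (ℕ; zero; suc; _+_; _*_; _∸_; _<_; _≤_; _<ᵇ_; _≡ᵇ_; _⊔_)
open import Data.Nat.Combinatorics using (_C_)
open import Data.Nat.DivMod using (_/_)
open import Data.Bool using (Bool; true; false; if_then_else_; _∧_; not)
open import Data.List using (List; []; _∷_; map; length; reverse; foldr; filter; upTo; lookup)
open import Data.List.Relation.Binary.Permutation.Propositional using (_↭_)
open import Data.List.Relation.Binary.Sublist.Propositional using (_⊆_)
open import Data.Fin using (Fin; cast)
open import Data.Product using (Σ; ∃; ∃-syntax; _×_; _,_)
open import Data.Empty using (⊥)
open import Data.Unit using (⊤)
open import Function.Bundles using (_⇔_)
open import Relation.Binary.PropositionalEquality using (_≡_)
open import Relation.Nullary using (¬_)

oneTo : ℕ → List ℕ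
oneTo n = map suc (upTo n)

IsPerm : ℕ → List ℕ → Set
IsPerm n π = π ↭ oneTo n

-- Stack-sorting map s(LnR) = s(L) s(R) n  (n the largest entry)

maxL : List ℕ → ℕ
maxL = foldr _⊔_ 0

splitAt= : ℕ → List ℕ → List ℕ × List ℕ
splitAt= m [] = [] , []
splitAt= m (x ∷ xs) with x ≡ᵇ m
... | true  = [] , xs
... | false with splitAt= m xs
...   | (l , r) = x ∷ l , r

-- fuel-driven version; fuel = length suffices
sFuel : ℕ → List ℕ → List ℕ
sFuel zero    _  = []
sFuel (suc f) [] = []
sFuel (suc f) (x ∷ xs) with splitAt= (maxL (x ∷ xs)) (x ∷ xs)
... | (l , r) = sFuel f l Data.List.++ sFuel f r Data.List.++ (maxL (x ∷ xs) ∷ [])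

s : List ℕ → List ℕ
s π = sFuel (length π) π

UniquelySorted : ℕ → List ℕ → Set
UniquelySorted n π =
  ∃[ σ ] (IsPerm n σ × s σ ≡ π × (∀ τ → IsPerm n τ → s τ ≡ π → τ ≡ σ))

SameRelOrder : List ℕ → List ℕ → Set
SameRelOrder σ τ =
  Σ (length σ ≡ length τ) λ eq →
    ∀ (i j : Fin (length σ)) →
      (lookup σ i < lookup σ j) ⇔ (lookup τ (cast eq i) < lookup τ (cast eq j))

Contains : List ℕ → List ℕ → Set
Contains π τ = ∃[ σ ] (σ ⊆ π × SameRelOrder σ τ)

Avoids : List ℕ → List ℕ → Set
Avoids π τ = ¬ Contains π τ

U132-312 : ℕ → List ℕ → Set
U132-312 n π =
  IsPerm n π × UniquelySorted n π
  × Avoids π (1 ∷ 3 ∷ 2 ∷ []) × Avoids π (3 ∷ 1 ∷ 2 ∷ [])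

-- Entry access (1-indexed, 0 outside range), descents, inverse, rot

at : List ℕ → ℕ → ℕ
at [] _ = 0
at (x ∷ xs) zero = 0
at (x ∷ xs) (suc zero) = x
at (x ∷ xs) (suc (suc i)) = at xs (suc i)

isDes : List ℕ → ℕ → Bool
isDes π i = (0 <ᵇ i) ∧ (i <ᵇ length π) ∧ (at π (suc i) <ᵇ at π i)

-- 1-based position of value v in π (0 if absent)
pos : ℕ → List ℕ → ℕ
pos v [] = 0
pos v (x ∷ xs) = if x ≡ᵇ v then 1 else (if pos v xs ≡ᵇ 0 then 0 else suc (pos v xs))

inv : List ℕ → List ℕ
inv π = map (λ j → pos j π) (oneTo (length π))

rot : List ℕ → List ℕ
rot π = reverse (inv π)

count : (ℕ → Bool) → List ℕ → ℕ
count p [] = 0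
count p (x ∷ xs) = if p x then suc (count p xs) else count p xs

swu : ℕ → List ℕ → List ℕ
swu i π with splitAt= i π
... | (pre , post) = map f π
  where
  Li = filter (λ y → y Data.Nat.<? i) pre
  Ri = filter (λ y → y Data.Nat.<? i) post
  -- x ∈ R_i is the m-th smallest with m = 1 + #{y ∈ R_i | y < x}
  -- x ∈ L_i is the m-th largest with m = 1 + #{y ∈ L_i | x < y}
  inR : ℕ → Bool
  inR x = not (count (λ y → y ≡ᵇ x) Ri ≡ᵇ 0)
  f : ℕ → ℕ
  f x = if x <ᵇ i
        then (if inR x
              then suc (count (λ y → y <ᵇ x) Ri)
              else i ∸ suc (count (λ y → x <ᵇ y) Li))
        else x

swdᵢ : ℕ → List ℕ → List ℕ
swdᵢ i π = reverse (swu i (reverse π))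

swd : List ℕ → List ℕ
swd π = foldr swdᵢ π (oneTo (length π))

data Step : Set where
  U D : Step

Bal : ℕ → List Step → Set
Bal h [] = h ≡ 0
Bal h (U ∷ w) = Bal (suc h) w
Bal zero (D ∷ w) = ⊥
Bal (suc h) (D ∷ w) = Bal h w

IsDyck : ℕ → List Step → Set
IsDyck k w = length w ≡ 2 * k × Bal 0 w

-- order of the antichain 𝒜_k on 𝐃_k
_≤𝒜_ : List Step → List Step → Set
x ≤𝒜 y = x ≡ y

InInt𝒜 : ℕ → List Step × List Step → Set
InInt𝒜 k (x , y) = IsDyck k x × IsDyck k y × x ≤𝒜 y

oneToL : ℕ → List ℕ
oneToL = oneTo

DL : ℕ → List ℕ → List Step × List Step
DL k π =
  map (λ i → if isDes π (n ∸ i) then D else U) (oneTo (2 * k)) ,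
  map (λ i → if isDes (rot π) i then U else D) (oneTo (2 * k))
  where n = suc (2 * k)

Catalan : ℕ → ℕ
Catalan k = ((2 * k) C k) / suc k

{-# OPTIONS --safe #-}
module Submission where

-- Avoiding 132 and 312 means that every entry is a maximum or a minimum of the prefix it ends,
-- so π is determined by the word r ∈ {U , D}* recording, from right to left, which of the two
-- occurs. If π ends in its maximum, a preimage of π under s consists of a splitting of the rest
-- of π into two factors together with a preimage of each. Hence π is sortable iff r is a ballot
-- word, and the first-return decomposition shows that the preimage is unique iff r is a Dyck
-- word: an unmatched U allows the maximum to be put on either side. The operator swd turns π into
-- the layered permutation with the same descents; layered permutations are involutions, so rot
-- only reverses it and both components of DL are r.

open import Defs
open import Data.Nat
open import Data.Nat.Properties
open import Data.Nat.Combinatorics using (_C_; nCk≡nC[n∸k]; nC1≡n; k>n⇒nCk≡0; nCk+nC[k+1]≡[n+1]C[k+1])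
open import Data.Nat.DivMod using (_/_; m*n/n≡m)
open import Data.Nat.Tactic.RingSolver using (solve-∀)
open import Data.Bool using (Bool; true; false; T; if_then_else_; not)
open import Data.Fin using (zero; suc)
open import Data.List using (List; []; _∷_; _++_; map; length; reverse; foldr; filter; replicate; upTo)
open import Data.List.Properties
open import Data.List.Membership.Propositional using (_∈_; find)
open import Data.List.Membership.Propositional.Properties using (∈-++⁺ˡ; ∈-++⁺ʳ; ∈-++⁻; ∈-map⁺; ∈-map⁻)
open import Data.List.Relation.Unary.All as All using (All; []; _∷_)
open import Data.List.Relation.Unary.All.Properties using (++⁺; ++⁻ˡ; ++⁻ʳ; map⁺; map⁻; ¬All⇒Any¬)
open import Data.List.Relation.Unary.AllPairs using ([]; _∷_)
open import Data.List.Relation.Unary.Any using (here; there)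
open import Data.List.Relation.Unary.Unique.Propositional using (Unique)
import Data.List.Relation.Unary.Unique.Propositional.Properties as Unique
open import Data.List.Relation.Binary.Sublist.Propositional using (_⊆_; []; _∷_; _∷ʳ_; from∈)
open import Data.List.Relation.Binary.Sublist.Propositional.Properties using (reverse⁺; All-resp-⊆)
import Data.List.Relation.Binary.Permutation.Propositional as Permutation
open import Data.List.Relation.Binary.Permutation.Propositional
  using (_↭_; ↭-refl; ↭-sym; ↭-trans; ↭-prep; ↭-reflexive; ↭⇒↭ₛ)
open import Data.List.Relation.Binary.Permutation.Propositional.Properties as Perm
  using (shift; All-resp-↭; ∈-resp-↭; ↭-length; ↭-reverse; drop-∷; ↭-map-inv)
import Data.List.Relation.Binary.Permutation.Setoid.Properties as PermSetoid
open import Data.Product using (_×_; _,_; proj₁; proj₂; ∃-syntax)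
open import Data.Sum using (_⊎_; inj₁; inj₂)
open import Data.Empty using (⊥; ⊥-elim)
open import Data.Unit using (⊤; tt)
open import Function using (_∘_)
open import Function.Bundles using (_⇔_; mk⇔; Equivalence)
open import Relation.Binary.Definitions using (tri<; tri≈; tri>)
open import Relation.Binary.PropositionalEquality
open import Relation.Nullary using (¬_; yes; no)

-- Ballot paths and stack sorting

-- Words are handled reversed throughout: the maximum that `s` puts last becomes the head of a list,
-- an extremum of a prefix becomes an extremum of the suffix it heads, and the reversals inside
-- `swdᵢ` cancel. A word of m entries has m - 1 letters, so cutting the entries into two nonempty
-- factors cuts the letters as `v ++ x ∷ u` and loses x. After the rise of the maximum the path is
-- at height 1. Ballot words v and u cost no height and x costs at most one, whence the ballot
-- condition. For a Dyck word the remaining path goes from 1 to exactly 0; this forces x to be the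
-- fall of the first return, so the cut is determined. The slides run from the largest index down.
-- At the stages that matter the word consists of finished layers, then the minima that still wait
-- for the maximum closing their layer, then an extremal word on the other remaining values. Hence
-- the prefix `Q` and the counter `t` in the statements about slides and layers.

Ballot : ℕ → List Step → Set
Ballot h [] = ⊤
Ballot h (U ∷ w) = Ballot (suc h) w
Ballot zero (D ∷ w) = ⊥
Ballot (suc h) (D ∷ w) = Ballot h w

ballot-suc : ∀ h w → Ballot h w → Ballot (suc h) w
ballot-suc h [] b = tt
ballot-suc h (U ∷ w) b = ballot-suc (suc h) w b
ballot-suc (suc h) (D ∷ w) b = ballot-suc h w b

ballot-lift : ∀ h w → Ballot 0 w → Ballot h w
ballot-lift zero w b = b
ballot-lift (suc h) w b = ballot-suc h w (ballot-lift h w b)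

ballot-++ : ∀ h v w → Ballot h v → Ballot 0 w → Ballot h (v ++ w)
ballot-++ h [] w _ b = ballot-lift h w b
ballot-++ h (U ∷ v) w a b = ballot-++ (suc h) v w a b
ballot-++ (suc h) (D ∷ v) w a b = ballot-++ h v w a b

-- Started at `suc h`, the path `v` stays at height at least 1, so one additional fall is
-- affordable.
ballot-++-D : ∀ h v w → Ballot h v → Ballot 0 w → Ballot (suc h) (v ++ D ∷ w)
ballot-++-D h [] w _ b = ballot-lift h w b
ballot-++-D h (U ∷ v) w a b = ballot-++-D (suc h) v w a b
ballot-++-D (suc h) (D ∷ v) w a b = ballot-++-D h v w a b

ballot-join : ∀ v x w → Ballot 0 v → Ballot 0 w → Ballot 1 (v ++ x ∷ w)
ballot-join v U w a b = ballot-++ 1 v (U ∷ w) (ballot-suc 0 v a) (ballot-suc 0 w b)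
ballot-join v D w a b = ballot-++-D 0 v w a b

bal⇒¬ballot : ∀ h w → Bal (suc h) w → ¬ Ballot h w
bal⇒¬ballot h (U ∷ w) p q = bal⇒¬ballot (suc h) w p q
bal⇒¬ballot (suc h) (D ∷ w) p q = bal⇒¬ballot h w p q

bal-++-D : ∀ h v w → Bal h v → Bal 0 w → Bal (suc h) (v ++ D ∷ w)
bal-++-D zero [] w p q = q
bal-++-D h (U ∷ v) w p q = bal-++-D (suc h) v w p q
bal-++-D (suc h) (D ∷ v) w p q = bal-++-D h v w p q

-- Before `x` the path is at height at least 1, and `w` never ends below its start. To end at 0 the
-- path must therefore be at exactly 1 before `x`, fall there, and return to 0 in `w`.
bal-factor : ∀ h v x w → Bal (suc h) (v ++ x ∷ w) → Ballot h v → Ballot 0 w →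
  Bal h v × x ≡ D × Bal 0 w
bal-factor h [] U w p _ b =
  ⊥-elim (bal⇒¬ballot (suc h) w p (ballot-lift (suc h) w b))
bal-factor zero [] D w p _ b = refl , refl , p
bal-factor (suc h) [] D w p _ b = ⊥-elim (bal⇒¬ballot h w p (ballot-lift h w b))
bal-factor h (U ∷ v) x w p a b = bal-factor (suc h) v x w p a b
bal-factor (suc h) (D ∷ v) x w p a b = bal-factor h v x w p a b

-- In either factorization the displayed D is the first step below the axis of the common word.
first-return-unique : ∀ h v v′ w w′ → Bal h v → Bal h v′ →
  v ++ D ∷ w ≡ v′ ++ D ∷ w′ → v ≡ v′
first-return-unique h [] [] w w′ p q e = refl
first-return-unique zero [] (U ∷ v′) w w′ p q ()
first-return-unique h (U ∷ v) (U ∷ v′) w w′ p q e =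
  cong (U ∷_) (first-return-unique (suc h) v v′ w w′ p q (∷-injectiveʳ e))
first-return-unique (suc h) (D ∷ v) (D ∷ v′) w w′ p q e =
  cong (D ∷_) (first-return-unique h v v′ w w′ p q (∷-injectiveʳ e))
first-return-unique (suc h) [] (x ∷ v′) w w′ () q e

-- First-return decompositions of Dyck and ballot words

data DyckTree : List Step → Set where
  leaf : DyckTree []
  node : ∀ {v w} → DyckTree v → DyckTree w → DyckTree (U ∷ v ++ D ∷ w)

-- The initial rise either is never matched (`rise`) or is matched by the fall of its first return
-- (`node`).
data BallotTree : List Step → Set where
  leaf : BallotTree []
  rise : ∀ {w} → BallotTree w → BallotTree (U ∷ w)
  node : ∀ {v w} → DyckTree v → BallotTree w → BallotTree (U ∷ v ++ D ∷ w)

-- A path from height h, cut at its first passages below the levels h, h − 1, ….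
BallotForest : ℕ → List Step → Set
BallotForest zero w = BallotTree w
BallotForest (suc h) w = BallotTree w ⊎
  ∃[ v ] ∃[ u ] (w ≡ v ++ D ∷ u × DyckTree v × BallotForest h u)

treeForest : ∀ h {w} → BallotTree w → BallotForest h w
treeForest zero t = t
treeForest (suc h) t = inj₁ t

-- The first passage of `w` below its start, if there is one, is the fall matching the new rise. The
-- rise and that passage enclose the first piece of the forest, and the result is grafted onto the
-- second piece. Keeping all first passages at once lets the decomposition follow the letters of the
-- word.
forest-U : ∀ h {w} → BallotForest (suc h) w → BallotForest h (U ∷ w)
forest-U h (inj₁ t) = treeForest h (rise t)
forest-U zero (inj₂ (v , u , refl , d , t)) = node d t
forest-U (suc h) (inj₂ (v , u , refl , d , inj₁ t)) = inj₁ (node d t)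
forest-U (suc h) (inj₂ (v , u , refl , d , inj₂ (v′ , u′ , refl , d′ , f))) =
  inj₂ (U ∷ v ++ D ∷ v′ , u′ ,
        cong (U ∷_) (sym (++-assoc v (D ∷ v′) (D ∷ u′))) , node d d′ , f)

ballotForest : ∀ h w → Ballot h w → BallotForest h w
ballotForest h [] b = treeForest h leaf
ballotForest h (U ∷ w) b = forest-U h (ballotForest (suc h) w b)
ballotForest (suc h) (D ∷ w) b = inj₂ ([] , w , refl , leaf , ballotForest h w b)

dyck⇒bal : ∀ {w} → DyckTree w → Bal 0 w
dyck⇒bal leaf = refl
dyck⇒bal (node {v} {w} d e) = bal-++-D 0 v w (dyck⇒bal d) (dyck⇒bal e)

bal⇒ballot : ∀ h w → Bal h w → Ballot h w
bal⇒ballot h [] p = tt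
bal⇒ballot h (U ∷ w) p = bal⇒ballot (suc h) w p
bal⇒ballot (suc h) (D ∷ w) p = bal⇒ballot h w p

-- The word of steps of a list each of whose entries is a strict extremum of the suffix it heads:
-- U for a maximum, D for a minimum.
data Shape : List ℕ → List Step → Set where
  single : ∀ {x} → Shape (x ∷ []) []
  up     : ∀ {x ρ r} → All (_< x) ρ → Shape ρ r → Shape (x ∷ ρ) (U ∷ r)
  down   : ∀ {x ρ r} → All (x <_) ρ → Shape ρ r → Shape (x ∷ ρ) (D ∷ r)

shape-length : ∀ {ρ r} → Shape ρ r → length ρ ≡ suc (length r)
shape-length single = refl
shape-length (up _ s) = cong suc (shape-length s)
shape-length (down _ s) = cong suc (shape-length s)

shape-≢[] : ∀ {ρ r} → Shape ρ r → ρ ≢ []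
shape-≢[] () refl

-- The lost letter `x` belongs to the last entry of `B`; it compares this entry with `A` and so says
-- nothing about `B` alone.
shape-cut : ∀ v x u {ρ} → Shape ρ (v ++ x ∷ u) →
  ∃[ B ] ∃[ A ] (ρ ≡ B ++ A × Shape B v × Shape A u)
shape-cut [] U u {y ∷ A} (up a s) = y ∷ [] , A , refl , single , s
shape-cut [] D u {y ∷ A} (down a s) = y ∷ [] , A , refl , single , s
shape-cut (U ∷ v) x u (up {y} a s) with shape-cut v x u s
... | B , A , refl , s₁ , s₂ = y ∷ B , A , refl , up (++⁻ˡ B a) s₁ , s₂
shape-cut (D ∷ v) x u (down {y} a s) with shape-cut v x u s
... | B , A , refl , s₁ , s₂ = y ∷ B , A , refl , down (++⁻ˡ B a) s₁ , s₂

shape-split : ∀ b B a A {r} → Shape ((b ∷ B) ++ a ∷ A) r →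
  ∃[ v ] ∃[ x ] ∃[ u ] (r ≡ v ++ x ∷ u × Shape (b ∷ B) v × Shape (a ∷ A) u)
shape-split b [] a A (up _ s) = [] , U , _ , refl , single , s
shape-split b [] a A (down _ s) = [] , D , _ , refl , single , s
shape-split b (c ∷ B) a A (up h s) with shape-split c B a A s
... | v , x , u , refl , s₁ , s₂ = U ∷ v , x , u , refl , up (++⁻ˡ (c ∷ B) h) s₁ , s₂
shape-split b (c ∷ B) a A (down h s) with shape-split c B a A s
... | v , x , u , refl , s₁ , s₂ = D ∷ v , x , u , refl , down (++⁻ˡ (c ∷ B) h) s₁ , s₂

-- Sorts σ ρ means that s σ is the reverse of ρ.
data Sorts : List ℕ → List ℕ → Set where
  empty : Sorts [] []
  node  : ∀ {m L R A B} → All (_< m) L → All (_≤ m) R → Sorts L A → Sorts R B →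
          Sorts (L ++ m ∷ R) (m ∷ B ++ A)

sorts-↭ : ∀ {σ ρ} → Sorts σ ρ → σ ↭ ρ
sorts-↭ empty = ↭-refl
sorts-↭ (node {m} {L} {R} {A} {B} _ _ p q) =
  ↭-trans (shift m L R) (↭-prep m
    (↭-trans (Perm.++⁺ (sorts-↭ p) (sorts-↭ q)) (Perm.++-comm A B)))

-- Agreement of the stack-sorting map with `Sorts`

maxL-≥ : ∀ xs → All (_≤ maxL xs) xs
maxL-≥ [] = []
maxL-≥ (x ∷ xs) = m≤m⊔n x (maxL xs) ∷
  All.map (λ p → ≤-trans p (m≤n⊔m x (maxL xs))) (maxL-≥ xs)

maxL-∈ : ∀ x xs → maxL (x ∷ xs) ∈ x ∷ xs
maxL-∈ x [] = here (⊔-identityʳ x)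
maxL-∈ x (y ∷ ys) with ⊔-sel x (maxL (y ∷ ys))
... | inj₁ e = here e
... | inj₂ e = there (subst (_∈ y ∷ ys) (sym e) (maxL-∈ y ys))

maxL-unique : ∀ {m xs} → m ∈ xs → All (_≤ m) xs → maxL xs ≡ m
maxL-unique {m} {x ∷ xs} i a =
  ≤-antisym (All.lookup a (maxL-∈ x xs)) (All.lookup (maxL-≥ (x ∷ xs)) i)

≡ᵇ-false : ∀ {m n} → m ≢ n → (m ≡ᵇ n) ≡ false
≡ᵇ-false {m} {n} ne with m ≡ᵇ n in e
... | false = refl
... | true = ⊥-elim (ne (≡ᵇ⇒≡ m n (subst T (sym e) tt)))

≡ᵇ-refl : ∀ n → (n ≡ᵇ n) ≡ true
≡ᵇ-refl zero = refl
≡ᵇ-refl (suc n) = ≡ᵇ-refl n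

splitAt=-++ : ∀ m L R → All (_≢ m) L → splitAt= m (L ++ m ∷ R) ≡ (L , R)
splitAt=-++ m [] R [] rewrite ≡ᵇ-refl m = refl
splitAt=-++ m (x ∷ L) R (ne ∷ a) rewrite ≡ᵇ-false ne | splitAt=-++ m L R a = refl

split-∈ : ∀ {m : ℕ} xs → m ∈ xs → ∃[ L ] ∃[ R ] (xs ≡ L ++ m ∷ R × All (_≢ m) L)
split-∈ {m} (x ∷ xs) i with x ≟ m
... | yes refl = [] , xs , refl , []
... | no ne with i
...   | here e = ⊥-elim (ne (sym e))
...   | there j with split-∈ xs j
...     | L , R , refl , a = x ∷ L , R , refl , ne ∷ a

sFuel-∷ : ∀ f x xs L R → splitAt= (maxL (x ∷ xs)) (x ∷ xs) ≡ (L , R) →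
  sFuel (suc f) (x ∷ xs) ≡ sFuel f L ++ sFuel f R ++ maxL (x ∷ xs) ∷ []
sFuel-∷ f x xs L R e rewrite e = refl

sFuel-node : ∀ f m L R → All (_< m) L → All (_≤ m) R →
  reverse (sFuel (suc f) (L ++ m ∷ R)) ≡ m ∷ reverse (sFuel f R) ++ reverse (sFuel f L)
sFuel-node f m L R a b = trans (cong reverse (step L refl)) rev
  where
  mx : maxL (L ++ m ∷ R) ≡ m
  mx = maxL-unique (∈-++⁺ʳ L (here refl)) (++⁺ (All.map <⇒≤ a) (≤-refl ∷ b))
  sp : splitAt= (maxL (L ++ m ∷ R)) (L ++ m ∷ R) ≡ (L , R)
  sp rewrite mx = splitAt=-++ m L R (All.map <⇒≢ a)
  -- `sFuel` unfolds only on a visible cons cell, whose head depends on whether `L` is empty; hence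
  -- the case distinction on a copy of `L`.
  step : ∀ L′ → L′ ≡ L → sFuel (suc f) (L ++ m ∷ R) ≡ sFuel f L ++ sFuel f R ++ m ∷ []
  step [] refl = trans (sFuel-∷ f m R [] R sp)
    (cong (λ z → sFuel f [] ++ sFuel f R ++ z ∷ []) mx)
  step (x ∷ L′) refl = trans (sFuel-∷ f x (L′ ++ m ∷ R) L R sp)
    (cong (λ z → sFuel f L ++ sFuel f R ++ z ∷ []) mx)
  rev : reverse (sFuel f L ++ sFuel f R ++ m ∷ []) ≡ m ∷ reverse (sFuel f R) ++ reverse (sFuel f L)
  rev = trans (reverse-++ (sFuel f L) _)
    (cong (_++ reverse (sFuel f L)) (reverse-++ (sFuel f R) (m ∷ [])))

sFuel-[] : ∀ f → sFuel f [] ≡ []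
sFuel-[] zero = refl
sFuel-[] (suc f) = refl

node-bounds : ∀ {f} L {m : ℕ} R → length (L ++ m ∷ R) ≤ suc f → length L ≤ f × length R ≤ f
node-bounds L {m} R le = ≤-trans (m≤m+n _ _) h , ≤-trans (m≤n+m _ _) h
  where h = s≤s⁻¹ (subst (_≤ _) (trans (length-++ L) (+-suc _ _)) le)

-- Repeated entries are allowed here: the cut is at the first occurrence of the maximum, so the
-- bound is strict on the left and weak on the right, as in `Sorts`.
sorts-sFuel : ∀ f σ → length σ ≤ f → Sorts σ (reverse (sFuel f σ))
sorts-sFuel f [] le rewrite sFuel-[] f = empty
sorts-sFuel (suc f) σ@(x ∷ xs) le with split-∈ σ (maxL-∈ x xs) | maxL-≥ σ
... | L , R , e , ne | ge = subst₂ Sorts (sym e)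
        (sym (trans (cong (reverse ∘ sFuel (suc f)) e) (sFuel-node f m L R a b)))
        (node a b (sorts-sFuel f L (proj₁ bd)) (sorts-sFuel f R (proj₂ bd)))
  where
  m = maxL σ
  ge′ : All (_≤ m) (L ++ m ∷ R)
  ge′ = subst (All (_≤ m)) e ge
  a = All.map (λ (p , q) → ≤∧≢⇒< p q) (All.zip (++⁻ˡ L ge′ , ne))
  b = All.tail (++⁻ʳ L ge′)
  bd = node-bounds L R (subst (λ z → length z ≤ suc f) e le)

sFuel-sorts : ∀ f {σ ρ} → length σ ≤ f → Sorts σ ρ → reverse (sFuel f σ) ≡ ρ
sFuel-sorts f le empty rewrite sFuel-[] f = refl
sFuel-sorts zero le (node {m} {L} _ _ _ _) =
  ⊥-elim (m+1+n≰m 0 (≤-trans (m≤n+m _ (length L)) (subst (_≤ 0) (length-++ L) le)))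
sFuel-sorts (suc f) le (node {m} {L} {R} a b p q) with node-bounds L R le
... | l , r = trans (sFuel-node f m L R a b)
  (cong₂ (λ x y → m ∷ x ++ y) (sFuel-sorts f r q) (sFuel-sorts f l p))

s⇒sorts : ∀ {σ π} → s σ ≡ π → Sorts σ (reverse π)
s⇒sorts {σ} refl = sorts-sFuel (length σ) σ ≤-refl

sorts⇒s : ∀ {σ π} → Sorts σ (reverse π) → s σ ≡ π
sorts⇒s {σ} p = reverse-injective (sFuel-sorts (length σ) ≤-refl p)

-- Existence and uniqueness of preimages

sorts-[] : ∀ {σ} → Sorts σ [] → σ ≡ []
sorts-[] empty = refl

sorts-tail≤ : ∀ {m L R A B} → All (_< m) L → All (_≤ m) R → Sorts L A → Sorts R B →
  All (_≤ m) (B ++ A)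
sorts-tail≤ a b p q = ++⁺ (All-resp-↭ (sorts-↭ q) b) (All-resp-↭ (sorts-↭ p) (All.map <⇒≤ a))

shape-max : ∀ {m ρ r} → All (_≤ m) ρ → Shape (m ∷ ρ) r →
  (ρ ≡ [] × r ≡ []) ⊎ ∃[ r′ ] (r ≡ U ∷ r′ × Shape ρ r′)
shape-max a single = inj₁ (refl , refl)
shape-max a (up _ s) = inj₂ (_ , refl , s)
shape-max {ρ = []} a (down _ ())
shape-max {ρ = x ∷ ρ} (p ∷ _) (down (q ∷ _) s) = ⊥-elim (<⇒≱ q p)

-- The path starts at height 1 because the rise of the maximum precedes it. If a factor is empty, no
-- letter is lost and `r` is a ballot word even from height 0.
concat-ballot : ∀ B A {r} → (∀ {v} → Shape B v → Ballot 0 v) →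
  (∀ {u} → Shape A u → Ballot 0 u) → Shape (B ++ A) r → Ballot 1 r
concat-ballot [] A {r} f g s = ballot-suc 0 r (g s)
concat-ballot (b ∷ B) [] {r} f g s =
  ballot-suc 0 r (f (subst (λ z → Shape z r) (++-identityʳ (b ∷ B)) s))
concat-ballot (b ∷ B) (a ∷ A) f g s with shape-split b B a A s
... | v , x , u , refl , s₁ , s₂ = ballot-join v x u (f s₁) (g s₂)

sorts⇒ballot : ∀ {σ ρ r} → Sorts σ ρ → Shape ρ r → Ballot 0 r
sorts⇒ballot (node {A = A} {B} a b p q) s with shape-max (sorts-tail≤ a b p q) s
... | inj₁ (_ , refl) = tt
... | inj₂ (r′ , refl , s′) = concat-ballot B A (sorts⇒ballot q) (sorts⇒ballot p) s′

sorts-< : ∀ {m σ ρ} → Sorts σ ρ → All (_< m) ρ → All (_< m) σ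
sorts-< p = All-resp-↭ (↭-sym (sorts-↭ p))

sorts-node : ∀ {x L R} A B → All (_< x) (B ++ A) → Sorts L A → Sorts R B →
  Sorts (L ++ x ∷ R) (x ∷ B ++ A)
sorts-node A B a p q =
  node (sorts-< p (++⁻ʳ B a)) (All.map <⇒≤ (sorts-< q (++⁻ˡ B a))) p q

-- Reversed, the image of `L ++ x ∷ R` is `x`, then the image of `R`, then that of `L`. So the part
-- under the first return is sorted from the right of the maximum and the rest from its left.
dyck⇒sorts : ∀ {r ρ} → DyckTree r → Shape ρ r → ∃[ σ ] Sorts σ ρ
dyck⇒sorts leaf (single {x}) = x ∷ [] , node [] [] empty empty
dyck⇒sorts (node {v} {w} d e) (up {x} a s) with shape-cut v D w s
... | B , A , refl , s₁ , s₂ with dyck⇒sorts d s₁ | dyck⇒sorts e s₂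
...   | R , q | L , p = L ++ x ∷ R , sorts-node A B a p q

ballot⇒sorts : ∀ {r ρ} → BallotTree r → Shape ρ r → ∃[ σ ] Sorts σ ρ
ballot⇒sorts leaf (single {x}) = x ∷ [] , node [] [] empty empty
ballot⇒sorts (rise t) (up {x} {ρ} a s) with ballot⇒sorts t s
... | σ , p = σ ++ x ∷ [] , sorts-node ρ [] a p empty
ballot⇒sorts (node {v} {w} d t) (up {x} a s) with shape-cut v D w s
... | B , A , refl , s₁ , s₂ with dyck⇒sorts d s₁ | ballot⇒sorts t s₂
...   | R , q | L , p = L ++ x ∷ R , sorts-node A B a p q

split-unique : ∀ {m : ℕ} L L′ {R R′} → All (_≢ m) L → All (_≢ m) L′ →
  L ++ m ∷ R ≡ L′ ++ m ∷ R′ → L ≡ L′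
split-unique [] [] _ _ _ = refl
split-unique [] (x ∷ L′) _ (ne ∷ _) e = ⊥-elim (ne (sym (∷-injectiveˡ e)))
split-unique (x ∷ L) [] (ne ∷ _) _ e = ⊥-elim (ne (∷-injectiveˡ e))
split-unique (x ∷ L) (y ∷ L′) (_ ∷ a) (_ ∷ b) e =
  cong₂ _∷_ (∷-injectiveˡ e) (split-unique L L′ a b (∷-injectiveʳ e))

-- A rise not matched by a fall lets the maximum be placed on either side of its subtree.
ballot⇒bal⊎many : ∀ {r ρ} → BallotTree r → Shape ρ r →
  Bal 0 r ⊎ ∃[ σ ] ∃[ τ ] (Sorts σ ρ × Sorts τ ρ × σ ≢ τ)
ballot⇒bal⊎many leaf s = inj₁ refl
ballot⇒bal⊎many (rise t) (up {x} {ρ} a s) with ballot⇒sorts t s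
... | σ , p = inj₂ (σ ++ x ∷ [] , x ∷ σ ,
        node (sorts-< p a) [] p empty ,
        subst (λ z → Sorts (x ∷ σ) (x ∷ z)) (++-identityʳ ρ)
          (node [] (All.map <⇒≤ (sorts-< p a)) empty p) ,
        λ e → shape-≢[] s (sorts-empty (split-unique σ [] (All.map <⇒≢ (sorts-< p a)) [] e) p))
  where
  sorts-empty : ∀ {σ ρ} → σ ≡ [] → Sorts σ ρ → ρ ≡ []
  sorts-empty _ empty = refl
  sorts-empty e (node {L = []} _ _ _ _) with () ← e
  sorts-empty e (node {L = _ ∷ _} _ _ _ _) with () ← e
ballot⇒bal⊎many (node {v} {w} d t) (up {x} a s) with shape-cut v D w s
... | B , A , refl , s₁ , s₂ with dyck⇒sorts d s₁ | ballot⇒bal⊎many t s₂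
...   | _ | inj₁ b = inj₁ (bal-++-D 0 v w (dyck⇒bal d) b)
...   | R , q | inj₂ (L , L′ , p , p′ , ne) = inj₂ (L ++ x ∷ R , L′ ++ x ∷ R ,
          sorts-node A B a p q , sorts-node A B a p′ q ,
          λ e → ne (split-unique L L′ (All.map <⇒≢ (sorts-< p (++⁻ʳ B a)))
                                      (All.map <⇒≢ (sorts-< p′ (++⁻ʳ B a))) e))

-- If a factor were empty, all of `r` would be a ballot word from height 0, although it ends one
-- level below its start.
concat-factor : ∀ B A {R L r} → Sorts R B → Sorts L A → Shape (B ++ A) r → Bal 1 r →
  ∃[ v ] ∃[ u ] (r ≡ v ++ D ∷ u × Bal 0 v × Bal 0 u × Shape B v × Shape A u)
concat-factor [] A {r = r} q p s b = ⊥-elim (bal⇒¬ballot 0 r b (sorts⇒ballot p s))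
concat-factor (b ∷ B) [] {r = r} q p s bal = ⊥-elim (bal⇒¬ballot 0 r bal
  (sorts⇒ballot q (subst (λ z → Shape z r) (++-identityʳ (b ∷ B)) s)))
concat-factor (b ∷ B) (a ∷ A) q p s bal with shape-split b B a A s
... | v , x , u , refl , s₁ , s₂
  with bal-factor 0 v x u bal (sorts⇒ballot q s₁) (sorts⇒ballot p s₂)
... | bv , refl , bu = v , u , refl , bv , bu , s₁ , s₂

++-injective : ∀ (B B′ : List ℕ) {A A′} → length B ≡ length B′ →
  B ++ A ≡ B′ ++ A′ → B ≡ B′ × A ≡ A′
++-injective [] [] _ e = refl , e
++-injective (x ∷ B) (y ∷ B′) l e with ++-injective B B′ (suc-injective l) (∷-injectiveʳ e)
... | p , q = cong₂ _∷_ (∷-injectiveˡ e) p , q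

-- Both preimages cut the tail at the first return of the same path, so `B` and `B′` have equal
-- length and the factors agree. The equation `ρ ≡ ρ′` is separate because two indices `m ∷ B ++ A`
-- do not unify.
sorts-unique : ∀ {σ τ ρ ρ′ r} → Bal 0 r → Shape ρ r → Sorts σ ρ → Sorts τ ρ′ → ρ ≡ ρ′ → σ ≡ τ
sorts-unique b s (node {A = A} {B} h k p q) (node {A = A′} {B′} h′ k′ p′ q′) e
  with refl ← ∷-injectiveˡ e | e′ ← ∷-injectiveʳ e | shape-max (sorts-tail≤ h k p q) s
... | inj₁ (z , refl)
  with refl ← ++-conicalˡ B A z | refl ← ++-conicalʳ B A z
     | refl ← ++-conicalˡ B′ A′ (trans (sym e′) z) | refl ← ++-conicalʳ B′ A′ (trans (sym e′) z)
  rewrite sorts-[] p | sorts-[] q | sorts-[] p′ | sorts-[] q′ = refl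
... | inj₂ (r′ , refl , s′)
  with concat-factor B A q p s′ b | concat-factor B′ A′ q′ p′ (subst (λ z → Shape z r′) e′ s′) b
... | v , u , refl , bv , bu , sB , sA | v′ , u′ , e″ , bv′ , bu′ , sB′ , sA′
  with refl ← first-return-unique 0 v v′ u u′ bv bv′ e″
  with refl , refl ← ++-injective B B′ (trans (shape-length sB) (sym (shape-length sB′))) e′
  = cong₂ (λ x y → x ++ _ ∷ y) (sorts-unique bu sA p p′ refl) (sorts-unique bv sB q q′ refl)
sorts-unique b () empty empty e

uniquelySorted⇒bal : ∀ {n π r} → IsPerm n π → Shape (reverse π) r → UniquelySorted n π → Bal 0 r
uniquelySorted⇒bal {π = π} {r} perm sh (σ , _ , eq , uniq)
  with ballot⇒bal⊎many (ballotForest 0 r (sorts⇒ballot (s⇒sorts {σ} eq) sh)) sh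
... | inj₁ b = b
... | inj₂ (σ₁ , σ₂ , p₁ , p₂ , ne) = ⊥-elim (ne (trans (only p₁) (sym (only p₂))))
  where
  only : ∀ {τ} → Sorts τ (reverse π) → τ ≡ σ
  only {τ} p = uniq τ (↭-trans (sorts-↭ p) (↭-trans (↭-reverse π) perm)) (sorts⇒s p)

bal⇒uniquelySorted : ∀ {n π r} → IsPerm n π → Shape (reverse π) r → Bal 0 r → UniquelySorted n π
bal⇒uniquelySorted {π = π} {r} perm sh b
  with ballot⇒sorts (ballotForest 0 r (bal⇒ballot 0 r b)) sh
... | σ , p = σ , ↭-trans (sorts-↭ p) (↭-trans (↭-reverse π) perm) , sorts⇒s p ,
  λ τ _ e → sorts-unique b sh (s⇒sorts {τ} e) p refl

-- Permutations avoiding 132 and 312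

run : ℕ → ℕ → List ℕ
run a zero = []
run a (suc t) = suc a ∷ run (suc a) t

map-suc-run : ∀ a t → map suc (run a t) ≡ run (suc a) t
map-suc-run a zero = refl
map-suc-run a (suc t) = cong (suc (suc a) ∷_) (map-suc-run (suc a) t)

oneTo-suc : ∀ n → oneTo (suc n) ≡ 1 ∷ map suc (oneTo n)
oneTo-suc n = cong (λ z → 1 ∷ map suc z) (sym (map-upTo suc n))

oneTo-run : ∀ n → oneTo n ≡ run 0 n
oneTo-run zero = refl
oneTo-run (suc n) = trans (oneTo-suc n)
  (cong (1 ∷_) (trans (cong (map suc) (oneTo-run n)) (map-suc-run 0 n)))

oneTo-∷ʳ : ∀ n → oneTo (suc n) ≡ oneTo n ++ suc n ∷ []
oneTo-∷ʳ n = trans (cong (map suc) (sym (upTo-∷ʳ n))) (map-++ suc (upTo n) (n ∷ []))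

run-> : ∀ a t → All (a <_) (run a t)
run-> a zero = []
run-> a (suc t) = ≤-refl ∷ All.map (<-trans ≤-refl) (run-> (suc a) t)

run-≤ : ∀ a t → All (_≤ a + t) (run a t)
run-≤ a zero = []
run-≤ a (suc t) rewrite +-suc a t = s≤s (m≤m+n a t) ∷ run-≤ (suc a) t

oneTo-≥1 : ∀ n → All (0 <_) (oneTo n)
oneTo-≥1 n rewrite oneTo-run n = run-> 0 n

oneTo-≤ : ∀ n → All (_≤ n) (oneTo n)
oneTo-≤ n rewrite oneTo-run n = run-≤ 0 n

oneTo-unique : ∀ n → Unique (oneTo n)
oneTo-unique n = Unique.map⁺ suc-injective (Unique.upTo⁺ n)

length-oneTo : ∀ n → length (oneTo n) ≡ n
length-oneTo n = trans (length-map suc (upTo n)) (length-upTo n)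

oneTo-↭ : ∀ n → suc n ∷ oneTo n ↭ oneTo (suc n)
oneTo-↭ n = ↭-trans (Perm.∷↭∷ʳ (suc n) (oneTo n)) (↭-reflexive (sym (oneTo-∷ʳ n)))

extremal : List Step → List ℕ
extremal [] = 1 ∷ []
extremal (U ∷ r) = suc (suc (length r)) ∷ extremal r
extremal (D ∷ r) = 1 ∷ map suc (extremal r)

extremal-↭ : ∀ r → extremal r ↭ oneTo (suc (length r))
extremal-↭ [] = ↭-refl
extremal-↭ (U ∷ r) = ↭-trans (↭-prep _ (extremal-↭ r)) (oneTo-↭ (suc (length r)))
extremal-↭ (D ∷ r) = ↭-trans (↭-prep 1 (Perm.map⁺ suc (extremal-↭ r)))
  (↭-reflexive (sym (oneTo-suc (suc (length r)))))

extremal-≥1 : ∀ r → All (0 <_) (extremal r)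
extremal-≥1 r = All-resp-↭ (↭-sym (extremal-↭ r)) (oneTo-≥1 _)

extremal-≤ : ∀ r → All (_≤ suc (length r)) (extremal r)
extremal-≤ r = All-resp-↭ (↭-sym (extremal-↭ r)) (oneTo-≤ _)

shape-map-suc : ∀ {ρ r} → Shape ρ r → Shape (map suc ρ) r
shape-map-suc single = single
shape-map-suc (up a s) = up (map⁺ (All.map s≤s a)) (shape-map-suc s)
shape-map-suc (down a s) = down (map⁺ (All.map s≤s a)) (shape-map-suc s)

shape-map-suc⁻ : ∀ ρ {r} → Shape (map suc ρ) r → Shape ρ r
shape-map-suc⁻ (x ∷ []) single = single
shape-map-suc⁻ (x ∷ y ∷ ρ) (up a s) = up (All.map s≤s⁻¹ (map⁻ a)) (shape-map-suc⁻ (y ∷ ρ) s)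
shape-map-suc⁻ (x ∷ y ∷ ρ) (down a s) = down (All.map s≤s⁻¹ (map⁻ a)) (shape-map-suc⁻ (y ∷ ρ) s)

extremal-shape : ∀ r → Shape (extremal r) r
extremal-shape [] = single
extremal-shape (U ∷ r) = up (All.map s≤s (extremal-≤ r)) (extremal-shape r)
extremal-shape (D ∷ r) = down (map⁺ (All.map s≤s (extremal-≥1 r))) (shape-map-suc (extremal-shape r))

max-head : ∀ {x ρ n} → All (_< x) ρ → x ∷ ρ ↭ oneTo (suc n) → x ≡ suc n
max-head {x} {ρ} {n} a p = ≤-antisym
  (All.lookup (oneTo-≤ (suc n)) (∈-resp-↭ p (here refl)))
  (All.lookup (≤-refl ∷ All.map <⇒≤ a)
    (∈-resp-↭ (↭-sym p) (subst (suc n ∈_) (sym (oneTo-∷ʳ n)) (∈-++⁺ʳ (oneTo n) (here refl)))))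

min-head : ∀ {x ρ n} → All (x <_) ρ → x ∷ ρ ↭ oneTo (suc n) → x ≡ 1
min-head {x} {ρ} {n} a p = ≤-antisym
  (All.lookup (≤-refl ∷ All.map <⇒≤ a) (∈-resp-↭ (↭-sym p) (here refl)))
  (All.lookup (oneTo-≥1 (suc n)) (∈-resp-↭ p (here refl)))

-- The head is forced to be the largest value or 1. Deleting a 1 leaves the values from 2 on, which
-- `↭-map-inv` lowers to a permutation again.
shape⇒extremal : ∀ {ρ r} → Shape ρ r → ρ ↭ oneTo (suc (length r)) → ρ ≡ extremal r
shape⇒extremal single p = cong (_∷ []) (max-head [] p)
shape⇒extremal {x ∷ ρ} {U ∷ r} (up a s) p with refl ← max-head a p =
  cong (_ ∷_) (shape⇒extremal s (drop-∷ (↭-trans p (↭-sym (oneTo-↭ (suc (length r)))))))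
shape⇒extremal {x ∷ ρ} {D ∷ r} (down a s) p with refl ← min-head a p
  with ↭-map-inv suc (↭-sym (drop-∷ (↭-trans p (↭-reflexive (oneTo-suc (suc (length r)))))))
... | ρ′ , refl , q = cong (λ z → 1 ∷ map suc z)
        (shape⇒extremal (shape-map-suc⁻ ρ′ s) (↭-sym q))

-- In reversed reading order the patterns 132 and 312 are the two ways for the first of three
-- entries to lie strictly between the other two.
FirstBetween : List ℕ → Set
FirstBetween ρ = ∃[ x ] ∃[ y ] ∃[ z ]
  (x ∷ y ∷ z ∷ [] ⊆ ρ × ((y < x × x < z) ⊎ (z < x × x < y)))

shape⇒¬firstBetween : ∀ {ρ r} → Shape ρ r → ¬ FirstBetween ρ
shape⇒¬firstBetween single (_ , _ , _ , refl ∷ () , _)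
shape⇒¬firstBetween single (_ , _ , _ , _ ∷ʳ () , _)
shape⇒¬firstBetween (up a s) (x , y , z , _ ∷ʳ p , o) = shape⇒¬firstBetween s (x , y , z , p , o)
shape⇒¬firstBetween (down a s) (x , y , z , _ ∷ʳ p , o) = shape⇒¬firstBetween s (x , y , z , p , o)
shape⇒¬firstBetween (up a s) (x , y , z , refl ∷ p , o) with All-resp-⊆ p a | o
... | _ ∷ l ∷ [] | inj₁ (_ , g) = <-asym l g
... | l ∷ _ ∷ [] | inj₂ (_ , g) = <-asym l g
shape⇒¬firstBetween (down a s) (x , y , z , refl ∷ p , o) with All-resp-⊆ p a | o
... | l ∷ _ ∷ [] | inj₁ (g , _) = <-asym l g
... | _ ∷ l ∷ [] | inj₂ (g , _) = <-asym l g

pair-⊆ : ∀ {y z : ℕ} {ρ} → y ∈ ρ → z ∈ ρ → y ≢ z → (y ∷ z ∷ [] ⊆ ρ) ⊎ (z ∷ y ∷ [] ⊆ ρ)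
pair-⊆ (here refl) (here refl) ne = ⊥-elim (ne refl)
pair-⊆ (here refl) (there j) ne = inj₁ (refl ∷ from∈ j)
pair-⊆ (there i) (here refl) ne = inj₂ (refl ∷ from∈ i)
pair-⊆ (there i) (there j) ne with pair-⊆ i j ne
... | inj₁ p = inj₁ (_ ∷ʳ p)
... | inj₂ p = inj₂ (_ ∷ʳ p)

¬firstBetween⇒shape : ∀ x ρ → Unique (x ∷ ρ) → ¬ FirstBetween (x ∷ ρ) → ∃[ r ] Shape (x ∷ ρ) r
¬firstBetween⇒shape x [] u nb = [] , single
¬firstBetween⇒shape x (y ∷ ρ) (ne ∷ u) nb
  with ¬firstBetween⇒shape y ρ u (λ (a , b , c , p , o) → nb (a , b , c , _ ∷ʳ p , o))
     | All.all? (_<? x) (y ∷ ρ) | All.all? (x <?_) (y ∷ ρ)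
... | r , s | yes a | _ = U ∷ r , up a s
... | r , s | no _ | yes a = D ∷ r , down a s
-- The head lies strictly between a larger entry `g` and a smaller entry `l`; in either order these
-- two complete a forbidden triple.
... | r , s | no ¬a | no ¬b
  with find (¬All⇒Any¬ (_<? x) _ ¬a) | find (¬All⇒Any¬ (x <?_) _ ¬b)
... | g , i , g≮x | l , j , x≮l
  with ≤∧≢⇒< (≮⇒≥ g≮x) (All.lookup ne i) | ≤∧≢⇒< (≮⇒≥ x≮l) (All.lookup ne j ∘ sym)
... | x<g | l<x with pair-⊆ i j (<⇒≢ (<-trans l<x x<g) ∘ sym)
... | inj₁ p = ⊥-elim (nb (x , g , l , refl ∷ p , inj₂ (l<x , x<g)))
... | inj₂ p = ⊥-elim (nb (x , l , g , refl ∷ p , inj₁ (l<x , x<g)))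

both : ∀ {A B : Set} → A → B → A ⇔ B
both a b = mk⇔ (λ _ → b) (λ _ → a)

neither : ∀ {A B : Set} → ¬ A → ¬ B → A ⇔ B
neither a b = mk⇔ (⊥-elim ∘ a) (⊥-elim ∘ b)

order-132 : ∀ {a b c} → a < c → c < b → SameRelOrder (a ∷ b ∷ c ∷ []) (1 ∷ 3 ∷ 2 ∷ [])
order-132 {a} {b} {c} p q = refl , rel
  where
  rel : ∀ i j → _
  rel zero zero = neither (<-irrefl refl) (<-irrefl refl)
  rel zero (suc zero) = both (<-trans p q) (s≤s (s≤s z≤n))
  rel zero (suc (suc zero)) = both p (s≤s (s≤s z≤n))
  rel (suc zero) zero = neither (<-asym (<-trans p q)) (<-asym (s≤s (s≤s z≤n)))
  rel (suc zero) (suc zero) = neither (<-irrefl refl) (<-irrefl refl)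
  rel (suc zero) (suc (suc zero)) = neither (<-asym q) (<-asym (s≤s (s≤s (s≤s z≤n))))
  rel (suc (suc zero)) zero = neither (<-asym p) (<-asym (s≤s (s≤s z≤n)))
  rel (suc (suc zero)) (suc zero) = both q (s≤s (s≤s (s≤s z≤n)))
  rel (suc (suc zero)) (suc (suc zero)) = neither (<-irrefl refl) (<-irrefl refl)

order-312 : ∀ {a b c} → b < c → c < a → SameRelOrder (a ∷ b ∷ c ∷ []) (3 ∷ 1 ∷ 2 ∷ [])
order-312 {a} {b} {c} p q = refl , rel
  where
  rel : ∀ i j → _
  rel zero zero = neither (<-irrefl refl) (<-irrefl refl)
  rel zero (suc zero) = neither (<-asym (<-trans p q)) (<-asym (s≤s (s≤s z≤n)))
  rel zero (suc (suc zero)) = neither (<-asym q) (<-asym (s≤s (s≤s (s≤s z≤n))))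
  rel (suc zero) zero = both (<-trans p q) (s≤s (s≤s z≤n))
  rel (suc zero) (suc zero) = neither (<-irrefl refl) (<-irrefl refl)
  rel (suc zero) (suc (suc zero)) = both p (s≤s (s≤s z≤n))
  rel (suc (suc zero)) zero = both q (s≤s (s≤s (s≤s z≤n)))
  rel (suc (suc zero)) (suc zero) = neither (<-asym p) (<-asym (s≤s (s≤s z≤n)))
  rel (suc (suc zero)) (suc (suc zero)) = neither (<-irrefl refl) (<-irrefl refl)

avoids⇒¬firstBetween : ∀ ρ → Avoids (reverse ρ) (1 ∷ 3 ∷ 2 ∷ []) → Avoids (reverse ρ) (3 ∷ 1 ∷ 2 ∷ []) →
  ¬ FirstBetween ρ
avoids⇒¬firstBetween ρ a b (x , y , z , p , inj₁ (y<x , x<z)) =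
  b (z ∷ y ∷ x ∷ [] , reverse⁺ p , order-312 y<x x<z)
avoids⇒¬firstBetween ρ a b (x , y , z , p , inj₂ (z<x , x<y)) =
  a (z ∷ y ∷ x ∷ [] , reverse⁺ p , order-132 z<x x<y)

¬firstBetween⇒avoids : ∀ π → ¬ FirstBetween (reverse π) →
  Avoids π (1 ∷ 3 ∷ 2 ∷ []) × Avoids π (3 ∷ 1 ∷ 2 ∷ [])
¬firstBetween⇒avoids π nb = no132 , no312
  where
  no132 : Avoids π (1 ∷ 3 ∷ 2 ∷ [])
  no132 (a ∷ b ∷ c ∷ [] , p , eq , f) = nb (c , b , a , reverse⁺ p , inj₂
    ( Equivalence.from (f zero (suc (suc zero))) (s≤s (s≤s z≤n))
    , Equivalence.from (f (suc (suc zero)) (suc zero)) (s≤s (s≤s (s≤s z≤n)))))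
  no312 : Avoids π (3 ∷ 1 ∷ 2 ∷ [])
  no312 (a ∷ b ∷ c ∷ [] , p , eq , f) = nb (c , b , a , reverse⁺ p , inj₁
    ( Equivalence.from (f (suc zero) (suc (suc zero))) (s≤s (s≤s z≤n))
    , Equivalence.from (f (suc (suc zero)) zero) (s≤s (s≤s (s≤s z≤n)))))

-- The operator swd

<ᵇ-true : ∀ {m n} → m < n → (m <ᵇ n) ≡ true
<ᵇ-true {m} {n} p with m <ᵇ n | <⇒<ᵇ p
... | true | _ = refl

<ᵇ-false : ∀ {m n} → n ≤ m → (m <ᵇ n) ≡ false
<ᵇ-false {m} {n} p with m <ᵇ n in e
... | false = refl
... | true = ⊥-elim (≤⇒≯ p (<ᵇ⇒< m n (subst T (sym e) tt)))

count-↭ : ∀ p {xs ys} → xs ↭ ys → count p xs ≡ count p ys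
count-↭ p Permutation.refl = refl
count-↭ p (Permutation.prep x q) with p x
... | true = cong suc (count-↭ p q)
... | false = count-↭ p q
count-↭ p (Permutation.swap x y q) with p x | p y
... | true | true = cong (2 +_) (count-↭ p q)
... | true | false = cong suc (count-↭ p q)
... | false | true = cong suc (count-↭ p q)
... | false | false = count-↭ p q
count-↭ p (Permutation.trans q r) = trans (count-↭ p q) (count-↭ p r)

<ᵇ-+ : ∀ b m n → ((b + m) <ᵇ (b + n)) ≡ (m <ᵇ n)
<ᵇ-+ zero m n = refl
<ᵇ-+ (suc b) m n = <ᵇ-+ b m n

count-<-+ : ∀ b v xs → count (_<ᵇ (b + v)) (map (b +_) xs) ≡ count (_<ᵇ v) xs
count-<-+ b v [] = refl
count-<-+ b v (x ∷ xs) rewrite <ᵇ-+ b x v =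
  cong (λ n → if x <ᵇ v then suc n else n) (count-<-+ b v xs)

count-none : ∀ p xs → All (λ x → p x ≡ false) xs → count p xs ≡ 0
count-none p [] [] = refl
count-none p (x ∷ xs) (e ∷ a) rewrite e = count-none p xs a

count-all : ∀ p xs → All (λ x → p x ≡ true) xs → count p xs ≡ length xs
count-all p [] [] = refl
count-all p (x ∷ xs) (e ∷ a) rewrite e = cong suc (count-all p xs a)

length-run : ∀ a t → length (run a t) ≡ t
length-run a zero = refl
length-run a (suc t) = cong suc (length-run (suc a) t)

count-<-run : ∀ a l u → u ≤ l → count (_<ᵇ suc (u + a)) (run a l) ≡ u
count-<-run a l zero _ = count-none _ _ (All.map <ᵇ-false (run-> a l))
count-<-run a (suc l) (suc u) (s≤s le)
  rewrite <ᵇ-true {a} {suc (u + a)} (s≤s (m≤n+m a u)) | sym (+-suc u a) =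
  cong suc (count-<-run (suc a) l u le)

count->-run : ∀ a l u → count (suc (u + a) <ᵇ_) (run a l) ≡ l ∸ suc u
count->-run a zero u = refl
count->-run a (suc l) u rewrite <ᵇ-false {u + a} {a} (m≤n+m a u) = rest u
  where
  rest : ∀ u → count (suc (u + a) <ᵇ_) (run (suc a) l) ≡ l ∸ u
  rest zero = trans (count-all _ _ (All.map <ᵇ-true (run-> (suc a) l))) (length-run (suc a) l)
  rest (suc u) = trans (cong (λ z → count (suc z <ᵇ_) (run (suc a) l)) (sym (+-suc u a)))
    (count->-run (suc a) l u)

member : ℕ → List ℕ → Bool
member x R = not (count (λ y → y ≡ᵇ x) R ≡ᵇ 0)

member-∈ : ∀ {x R} → x ∈ R → member x R ≡ true
member-∈ {x} (here refl) rewrite ≡ᵇ-refl x = refl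
member-∈ {x} {y ∷ R} (there i) with y ≡ᵇ x
... | true = refl
... | false = member-∈ i

member-∉ : ∀ {x R} → All (_≢ x) R → member x R ≡ false
member-∉ a rewrite count-none _ _ (All.map ≡ᵇ-false a) = refl

-- The relabelling of entries performed by swu i, where L = L_i and R = R_i.
relabel : ℕ → List ℕ → List ℕ → ℕ → ℕ
relabel i L R x =
  if x <ᵇ i
  then (if member x R
        then suc (count (λ y → y <ᵇ x) R)
        else i ∸ suc (count (λ y → x <ᵇ y) L))
  else x

swu-++ : ∀ i A S → All (_≢ i) A → swu i (A ++ i ∷ S) ≡
  map (relabel i (filter (_<? i) A) (filter (_<? i) S)) (A ++ i ∷ S)
swu-++ i A S a rewrite splitAt=-++ i A S a = refl

map-run : ∀ f a p l → (∀ u → u < l → f (suc (u + a)) ≡ suc (u + p)) → map f (run a l) ≡ run p l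
map-run f a p zero h = refl
map-run f a p (suc l) h = cong₂ _∷_ (h 0 (s≤s z≤n)) (map-run f (suc a) (suc p) l λ u lt →
  trans (cong (f ∘ suc) (+-suc u a)) (trans (h (suc u) (s≤s lt)) (cong suc (sym (+-suc u p)))))

filter-run : ∀ i Q M → All (i ≤_) Q → All (_< i) M → filter (_<? i) (Q ++ M) ≡ M
filter-run i Q M q m = trans (filter-++ (_<? i) Q M)
  (cong₂ _++_ (filter-none (_<? i) (All.map ≤⇒≯ q)) (filter-all (_<? i) m))

-- The small entries left of the index form a run of length `l` and those right of it a shifted
-- permutation of [p]. Sliding gives the left ones the values `p + 1` to `p + l` and the right ones
-- 1 to `p`. As `swu` selects the rule by membership among the right entries, the two ranges of
-- values have to be disjoint.
swu-slide : ∀ a b l p Q S T → T ↭ oneTo p → a + l ≤ l + p → b + p ≤ l + p →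
  a + l ≤ b ⊎ b + p ≤ a → All (suc (l + p) <_) Q → All (suc (l + p) <_) S →
  swu (suc (l + p)) (Q ++ run a l ++ suc (l + p) ∷ S ++ map (b +_) T) ≡
  Q ++ run p l ++ suc (l + p) ∷ S ++ T
swu-slide a b l p Q S T t a≤ b≤ dis Q> S> = begin
  swu i (Q ++ run a l ++ i ∷ S ++ R)
    ≡⟨ cong (swu i) (sym (++-assoc Q (run a l) _)) ⟩
  swu i ((Q ++ run a l) ++ i ∷ S ++ R)
    ≡⟨ swu-++ i (Q ++ run a l) (S ++ R)
         (++⁺ (All.map (λ lt e → <⇒≢ lt (sym e)) Q>) (All.map <⇒≢ run<)) ⟩
  map (relabel i (filter (_<? i) (Q ++ run a l)) (filter (_<? i) (S ++ R)))
      ((Q ++ run a l) ++ i ∷ S ++ R)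
    ≡⟨ cong₂ (λ x y → map (relabel i x y) ((Q ++ run a l) ++ i ∷ S ++ R))
         (filter-run i Q (run a l) (All.map <⇒≤ Q>) run<)
         (filter-run i S R (All.map <⇒≤ S>) R<) ⟩
  map f ((Q ++ run a l) ++ i ∷ S ++ R)
    ≡⟨ cong (map f) (++-assoc Q (run a l) _) ⟩
  map f (Q ++ run a l ++ i ∷ S ++ R)
    ≡⟨ map-++ f Q _ ⟩
  map f Q ++ map f (run a l ++ i ∷ S ++ R)
    ≡⟨ cong₂ _++_ (map-id-local (All.map (f-big ∘ <⇒≤) Q>)) (map-++ f (run a l) _) ⟩
  Q ++ map f (run a l) ++ f i ∷ map f (S ++ R)
    ≡⟨ cong (Q ++_) (cong₂ _++_ (map-run f a p l f-run) (cong₂ _∷_ (f-big ≤-refl)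
         (trans (map-++ f S R) (cong₂ _++_ (map-id-local (All.map (f-big ∘ <⇒≤) S>)) f-R)))) ⟩
  Q ++ run p l ++ i ∷ S ++ T ∎
  where
  open ≡-Reasoning
  i = suc (l + p)
  R = map (b +_) T
  f = relabel i (run a l) R
  T≤ : All (_≤ p) T
  T≤ = All-resp-↭ (↭-sym t) (oneTo-≤ p)
  T≥ : All (0 <_) T
  T≥ = All-resp-↭ (↭-sym t) (oneTo-≥1 p)
  run< : All (_< i) (run a l)
  run< = All.map (λ q → s≤s (≤-trans q a≤)) (run-≤ a l)
  R< : All (_< i) R
  R< = map⁺ (All.map (λ q → s≤s (≤-trans (+-monoʳ-≤ b q) b≤)) T≤)
  f-big : ∀ {x} → i ≤ x → f x ≡ x
  f-big le rewrite <ᵇ-false le = refl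
  disjoint : ∀ u → u < l → a + l ≤ b ⊎ b + p ≤ a → All (_≢ suc (u + a)) R
  disjoint u lt (inj₁ q) = map⁺ (All.map (λ {x} x≥ e → <⇒≢ (≤-<-trans
    (≤-trans (+-monoˡ-≤ a lt) (≤-trans (≤-reflexive (+-comm l a)) q)) (m<m+n b x≥)) (sym e)) T≥)
  disjoint u lt (inj₂ q) = map⁺ (All.map (λ {x} x≤ → <⇒≢ (s≤s
    (≤-trans (+-monoʳ-≤ b x≤) (≤-trans q (m≤n+m a u))))) T≤)
  f-run : ∀ u → u < l → f (suc (u + a)) ≡ suc (u + p)
  f-run u lt
    rewrite <ᵇ-true {u + a} {l + p} (≤-trans (s≤s (≤-reflexive (+-comm u a)))
                     (≤-trans (≤-reflexive (sym (+-suc a u))) (≤-trans (+-monoʳ-≤ a lt) a≤)))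
          | member-∉ {suc (u + a)} {R} (disjoint u lt dis)
          | count->-run a l u
    = begin
    l + p ∸ (l ∸ suc u)   ≡⟨ cong (_∸ (l ∸ suc u)) (+-comm l p) ⟩
    p + l ∸ (l ∸ suc u)   ≡⟨ +-∸-assoc p (m∸n≤m l (suc u)) ⟩
    p + (l ∸ (l ∸ suc u)) ≡⟨ cong (p +_) (m∸[m∸n]≡n lt) ⟩
    p + suc u             ≡⟨ +-comm p (suc u) ⟩
    suc (u + p)           ∎
  f-elem : ∀ {v} → v ∈ T → f (b + v) ≡ v
  f-elem {v} m with All.lookup T≥ m | All.lookup T≤ m
  f-elem {suc v} m | _ | v≤
    rewrite <ᵇ-true (All.lookup R< (∈-map⁺ (b +_) m))
          | member-∈ (∈-map⁺ (b +_) m)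
          | count-<-+ b (suc v) T
          | count-↭ (_<ᵇ suc v) t
          | oneTo-run p
    = cong suc (trans (cong (λ z → count (_<ᵇ suc z) (run 0 p)) (sym (+-identityʳ v)))
        (count-<-run 0 p v (<⇒≤ v≤)))
  f-R : map f R ≡ T
  f-R = trans (sym (map-∘ T)) (map-id-local (All.tabulate f-elem))

-- Sliding an extremal word into layers

slides : ℕ → List ℕ → List ℕ
slides zero ρ = ρ
slides (suc n) ρ = slides n (swu (suc n) ρ)

foldr-swu : ∀ n ρ → foldr swu ρ (oneTo n) ≡ slides n ρ
foldr-swu zero ρ = refl
foldr-swu (suc n) ρ = trans (cong (foldr swu ρ) (oneTo-∷ʳ n))
  (trans (foldr-++ swu ρ (oneTo n) (suc n ∷ [])) (foldr-swu n (swu (suc n) ρ)))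

-- The inner reversals of consecutive operators cancel, leaving one at each end.
foldr-swd : ∀ is π → foldr swdᵢ π is ≡ reverse (foldr swu (reverse π) is)
foldr-swd [] π = sym (reverse-involutive π)
foldr-swd (i ∷ is) π rewrite foldr-swd is π =
  cong (reverse ∘ swu i) (reverse-involutive (foldr swu (reverse π) is))

swd-slides : ∀ π → swd π ≡ reverse (slides (length π) (reverse π))
swd-slides π = trans (foldr-swd (oneTo (length π)) π)
  (cong reverse (foldr-swu (length π) (reverse π)))

-- Reversed layered permutation: each maximal block of j falls becomes a run of j + 1
-- consecutive values; t counts the falls of the block being read.
layered : ℕ → List Step → List ℕ
layered t [] = run 0 (suc t)
layered t (U ∷ r) = run (suc (length r)) (suc t) ++ layered 0 r
layered t (D ∷ r) = layered (suc t) r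

run-++ : ∀ a j k → run a (j + k) ≡ run a j ++ run (j + a) k
run-++ a zero k = refl
run-++ a (suc j) k = cong (suc a ∷_) (trans (run-++ (suc a) j k)
  (cong (λ z → run (suc a) j ++ run z k) (+-suc j a)))

run-split : ∀ {a t} j → j < t → ∃[ k ] (t ≡ j + suc k ×
  run a t ≡ run a j ++ suc (j + a) ∷ run (suc (j + a)) k)
run-split {a} {t} j lt with m≤n⇒∃[o]m+o≡n lt
... | k , refl = k , sym (+-suc j k) , trans (cong (run a) (sym (+-suc j k))) (run-++ a j (suc k))

-- At an index inside a finished layer, the smaller entries of the layer are already the largest
-- values below the index and `T` holds the smallest, so nothing moves.
slides-done : ∀ j u p Q T → j ≤ u → T ↭ oneTo p → All (u + p <_) Q →
  slides (j + p) (Q ++ run p u ++ T) ≡ slides p (Q ++ run p u ++ T)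
slides-done zero u p Q T _ t Q> = refl
slides-done (suc j) u p Q T j<u t Q> with run-split {p} j j<u
... | k , refl , e = trans (cong (slides (j + p)) fixed) (slides-done j u p Q T (<⇒≤ j<u) t Q>)
  where
  open ≡-Reasoning
  shape : ∀ X → Q ++ run p u ++ X ≡ Q ++ run p j ++ suc (j + p) ∷ run (suc (j + p)) k ++ X
  shape X = cong (Q ++_) (trans (cong (_++ X) e) (++-assoc (run p j) _ X))
  fixed : swu (suc (j + p)) (Q ++ run p u ++ T) ≡ Q ++ run p u ++ T
  fixed = begin
    swu (suc (j + p)) (Q ++ run p u ++ T)
      ≡⟨ cong (swu (suc (j + p))) (trans (shape T)
           (cong (λ z → Q ++ run p j ++ suc (j + p) ∷ run (suc (j + p)) k ++ z) (sym (map-id T)))) ⟩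
    swu (suc (j + p)) (Q ++ run p j ++ suc (j + p) ∷ run (suc (j + p)) k ++ map (0 +_) T)
      ≡⟨ swu-slide p 0 j p Q (run (suc (j + p)) k) T t (≤-reflexive (+-comm p j)) (m≤n+m p j)
           (inj₂ ≤-refl) (All.map (≤-<-trans (+-monoˡ-≤ p j<u)) Q>) (run-> _ k) ⟩
    Q ++ run p j ++ suc (j + p) ∷ run (suc (j + p)) k ++ T
      ≡⟨ shape T ⟨
    Q ++ run p u ++ T ∎

run-∷ʳ : ∀ a t → run a (suc t) ≡ run a t ++ suc (t + a) ∷ []
run-∷ʳ a t = trans (cong (run a) (sym (+-comm t 1))) (run-++ a t 1)

-- A fall extends the run of waiting minima without any slide. At a rise the head is the largest
-- remaining value: its slide lifts the `t` minima to just below it and lowers the rest by `t`,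
-- which completes a layer. The next `t` slides fix the word, and the layer joins `Q`.
slides-extremal : ∀ t r Q → All (suc (t + length r) <_) Q →
  slides (suc (t + length r)) (Q ++ run 0 t ++ map (t +_) (extremal r)) ≡ Q ++ layered t r
slides-extremal t [] Q Q> = begin
  slides (suc t + 0) (Q ++ run 0 t ++ t + 1 ∷ [])
    ≡⟨ cong (λ z → slides (suc t + 0) (Q ++ z)) last ⟩
  slides (suc t + 0) (Q ++ run 0 (suc t) ++ [])
    ≡⟨ slides-done (suc t) (suc t) 0 Q [] ≤-refl ↭-refl Q> ⟩
  Q ++ run 0 (suc t) ++ []
    ≡⟨ cong (Q ++_) (++-identityʳ _) ⟩
  Q ++ run 0 (suc t) ∎
  where
  open ≡-Reasoning
  last : run 0 t ++ t + 1 ∷ [] ≡ run 0 (suc t) ++ []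
  last = trans (cong (λ z → run 0 t ++ z ∷ []) (+-suc t 0))
    (trans (sym (run-∷ʳ 0 t)) (sym (++-identityʳ _)))
slides-extremal t (D ∷ r) Q Q> = begin
  slides (suc (t + suc (length r))) (Q ++ run 0 t ++ t + 1 ∷ map (t +_) (map suc (extremal r)))
    ≡⟨ cong₂ (λ x y → slides (suc x) (Q ++ y)) (+-suc t _) regroup ⟩
  slides (suc (suc t + length r)) (Q ++ run 0 (suc t) ++ map (suc t +_) (extremal r))
    ≡⟨ slides-extremal (suc t) r Q (subst (λ z → All (suc z <_) Q) (+-suc t _) Q>) ⟩
  Q ++ layered (suc t) r ∎
  where
  open ≡-Reasoning
  regroup : run 0 t ++ t + 1 ∷ map (t +_) (map suc (extremal r)) ≡
            run 0 (suc t) ++ map (suc t +_) (extremal r)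
  regroup = begin
    run 0 t ++ t + 1 ∷ map (t +_) (map suc (extremal r))
      ≡⟨ cong₂ (λ x y → run 0 t ++ x ∷ y) (+-suc t 0)
           (trans (sym (map-∘ (extremal r))) (map-cong (+-suc t) (extremal r))) ⟩
    run 0 t ++ suc (t + 0) ∷ map (suc t +_) (extremal r)
      ≡⟨ ++-assoc (run 0 t) _ _ ⟨
    (run 0 t ++ suc (t + 0) ∷ []) ++ map (suc t +_) (extremal r)
      ≡⟨ cong (_++ map (suc t +_) (extremal r)) (run-∷ʳ 0 t) ⟨
    run 0 (suc t) ++ map (suc t +_) (extremal r) ∎
slides-extremal t (U ∷ r) Q Q> = begin
  slides (t + p) (swu (suc (t + p)) (Q ++ run 0 t ++ t + suc p ∷ map (t +_) (extremal r)))
    ≡⟨ cong (λ z → slides (t + p) (swu (suc (t + p)) (Q ++ run 0 t ++ z ∷ map (t +_) (extremal r))))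
         (+-suc t p) ⟩
  slides (t + p) (swu (suc (t + p)) (Q ++ run 0 t ++ suc (t + p) ∷ map (t +_) (extremal r)))
    ≡⟨ cong (slides (t + p)) (swu-slide 0 t t p Q [] (extremal r) (extremal-↭ r) (m≤m+n t p) ≤-refl
         (inj₁ ≤-refl) Q> []) ⟩
  slides (t + p) (Q ++ run p t ++ suc (t + p) ∷ extremal r)
    ≡⟨ cong (λ z → slides (t + p) (Q ++ z))
         (trans (sym (++-assoc (run p t) _ _)) (cong (_++ extremal r) (sym (run-∷ʳ p t)))) ⟩
  slides (t + p) (Q ++ run p (suc t) ++ extremal r)
    ≡⟨ slides-done t (suc t) p Q (extremal r) (n≤1+n t) (extremal-↭ r) Q> ⟩
  slides p (Q ++ run p (suc t) ++ extremal r)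
    ≡⟨ cong (slides p) (trans (sym (++-assoc Q _ _))
         (cong ((Q ++ run p (suc t)) ++_) (sym (map-id (extremal r))))) ⟩
  slides p ((Q ++ run p (suc t)) ++ map (0 +_) (extremal r))
    ≡⟨ slides-extremal 0 r (Q ++ run p (suc t))
         (++⁺ (All.map (≤-<-trans (m≤n+m p (suc t))) Q>) (run-> p (suc t))) ⟩
  (Q ++ run p (suc t)) ++ layered 0 r
    ≡⟨ ++-assoc Q _ _ ⟩
  Q ++ run p (suc t) ++ layered 0 r ∎
  where
  open ≡-Reasoning
  p = suc (length r)

swd-extremal : ∀ r → swd (reverse (extremal r)) ≡ reverse (layered 0 r)
swd-extremal r = trans (swd-slides (reverse (extremal r))) (cong reverse (begin
  slides (length (reverse (extremal r))) (reverse (reverse (extremal r)))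
    ≡⟨ cong₂ slides (trans (length-reverse (extremal r)) (shape-length (extremal-shape r)))
         (reverse-involutive (extremal r)) ⟩
  slides (suc (length r)) (extremal r)
    ≡⟨ cong (slides (suc (length r))) (map-id (extremal r)) ⟨
  slides (suc (length r)) (map (0 +_) (extremal r))
    ≡⟨ slides-extremal 0 r [] [] ⟩
  layered 0 r ∎))
  where open ≡-Reasoning

-- Descents and inverses of layered permutations

unique-↭ : ∀ {xs ys : List ℕ} → xs ↭ ys → Unique xs → Unique ys
unique-↭ p = PermSetoid.Unique-resp-↭ (setoid ℕ) (↭⇒↭ₛ p)

layered-↭ : ∀ t r → layered t r ↭ oneTo (suc (t + length r))
layered-↭ t [] = ↭-reflexive (trans (sym (oneTo-run (suc t))) (cong (oneTo ∘ suc) (sym (+-identityʳ t))))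
layered-↭ t (D ∷ r) = ↭-trans (layered-↭ (suc t) r)
  (↭-reflexive (cong (oneTo ∘ suc) (sym (+-suc t (length r)))))
layered-↭ t (U ∷ r) = ↭-trans (Perm.++-comm (run p (suc t)) (layered 0 r))
  (↭-trans (Perm.++⁺ʳ (run p (suc t)) (layered-↭ 0 r)) (↭-reflexive (begin
    oneTo p ++ run p (suc t)       ≡⟨ cong (_++ run p (suc t)) (oneTo-run p) ⟩
    run 0 p ++ run p (suc t)       ≡⟨ cong (λ z → run 0 p ++ run z (suc t)) (+-identityʳ p) ⟨
    run 0 p ++ run (p + 0) (suc t) ≡⟨ run-++ 0 p (suc t) ⟨
    run 0 (p + suc t)              ≡⟨ oneTo-run (p + suc t) ⟨
    oneTo (p + suc t)              ≡⟨ cong oneTo (+-comm p (suc t)) ⟩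
    oneTo (suc (t + p))            ∎)))
  where
  open ≡-Reasoning
  p = suc (length r)

layered-length : ∀ t r → length (layered t r) ≡ suc (t + length r)
layered-length t r = trans (↭-length (layered-↭ t r)) (length-oneTo _)

stepOf : ℕ → ℕ → Step
stepOf x y = if x <ᵇ y then D else U

steps : List ℕ → List Step
steps [] = []
steps (x ∷ []) = []
steps (x ∷ y ∷ l) = stepOf x y ∷ steps (y ∷ l)

steps-run : ∀ a t → steps (run a (suc t)) ≡ replicate t D
steps-run a zero = refl
steps-run a (suc t) rewrite <ᵇ-true {a} {suc a} ≤-refl = cong (D ∷_) (steps-run (suc a) t)

steps-run-++ : ∀ a t x l → x ≤ a → steps (run a (suc t) ++ x ∷ l) ≡ replicate t D ++ U ∷ steps (x ∷ l)
steps-run-++ a zero x l x≤ rewrite <ᵇ-false {suc a} {x} (m≤n⇒m≤1+n x≤) = refl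
steps-run-++ a (suc t) x l x≤ rewrite <ᵇ-true {a} {suc a} ≤-refl =
  cong (D ∷_) (steps-run-++ (suc a) t x l (m≤n⇒m≤1+n x≤))

replicate-D : ∀ t r → replicate t D ++ D ∷ r ≡ replicate (suc t) D ++ r
replicate-D zero r = refl
replicate-D (suc t) r = cong (D ∷_) (replicate-D t r)

-- The `t` falls already absorbed into the open layer reappear in front. Each new layer lies below
-- the previous one, which gives the U between them.
steps-layered : ∀ t r → steps (layered t r) ≡ replicate t D ++ r
steps-layered t [] = trans (steps-run 0 t) (sym (++-identityʳ _))
steps-layered t (D ∷ r) = trans (steps-layered (suc t) r) (sym (replicate-D t r))
steps-layered t (U ∷ r) with layered 0 r | steps-layered 0 r | layered-length 0 r
                           | All-resp-↭ (↭-sym (layered-↭ 0 r)) (oneTo-≤ (suc (length r)))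
... | x ∷ l | e | _ | x≤ ∷ _ = trans (steps-run-++ _ t x l x≤) (cong (λ z → replicate t D ++ U ∷ z) e)

-- Recording the number of entries on both sides of the pair makes reversal a mere exchange of `i`
-- with `j` and of `x` with `y`.
Adjacent : List ℕ → ℕ → ℕ → ℕ → ℕ → Set
Adjacent l i x y j = ∃[ A ] ∃[ B ] (l ≡ A ++ x ∷ y ∷ B × i ≡ length A × j ≡ length B)

map-steps : ∀ (f : ℕ → Step) x l →
  (∀ {i y z j} → Adjacent (x ∷ l) i y z j → f (suc i) ≡ stepOf y z) →
  map f (oneTo (length l)) ≡ steps (x ∷ l)
map-steps f x [] h = refl
map-steps f x (y ∷ l) h = trans (cong (map f) (oneTo-suc (length l)))
  (cong₂ _∷_ (h ([] , l , refl , refl , refl))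
    (trans (sym (map-∘ (oneTo (length l))))
      (map-steps (f ∘ suc) y l λ (A , B , e , p , q) →
        h (x ∷ A , B , cong (x ∷_) e , cong suc p , q))))

at-++ : ∀ A x B → at (A ++ x ∷ B) (suc (length A)) ≡ x
at-++ [] x B = refl
at-++ (y ∷ A) x B = at-++ A x B

at-suc-++ : ∀ A x y B → at (A ++ x ∷ y ∷ B) (suc (suc (length A))) ≡ y
at-suc-++ [] x y B = refl
at-suc-++ (z ∷ A) x y B = at-suc-++ A x y B

length-++-∷∷ : ∀ (A : List ℕ) x y B → length (A ++ x ∷ y ∷ B) ≡ suc (suc (length A + length B))
length-++-∷∷ A x y B = trans (length-++ A)
  (trans (+-suc (length A) _) (cong suc (+-suc (length A) _)))

isDes-++ : ∀ A x y B → isDes (A ++ x ∷ y ∷ B) (suc (length A)) ≡ (y <ᵇ x)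
isDes-++ A x y B
  rewrite at-++ A x (y ∷ B) | at-suc-++ A x y B | length-++-∷∷ A x y B
        | <ᵇ-true (s≤s (m≤m+n (length A) (length B))) = refl

adjacent-length : ∀ {l i x y j} → Adjacent l i x y j → length l ≡ suc (suc (i + j))
adjacent-length {x = x} {y} (A , B , refl , refl , refl) = length-++-∷∷ A x y B

adjacent-isDes : ∀ {l i x y j} → Adjacent l i x y j → isDes l (suc i) ≡ (y <ᵇ x)
adjacent-isDes {x = x} {y} (A , B , refl , refl , refl) = isDes-++ A x y B

adjacent-reverse : ∀ {l i x y j} → Adjacent l i x y j → Adjacent (reverse l) j y x i
adjacent-reverse {x = x} {y} (A , B , refl , refl , refl) =
  reverse B , reverse A , eq , sym (length-reverse B) , sym (length-reverse A)
  where
  open ≡-Reasoning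
  eq : reverse (A ++ x ∷ y ∷ B) ≡ reverse B ++ y ∷ x ∷ reverse A
  eq = begin
    reverse (A ++ x ∷ y ∷ B)
      ≡⟨ reverse-++ A _ ⟩
    reverse (x ∷ y ∷ B) ++ reverse A
      ≡⟨ cong (_++ reverse A) (reverse-++ (x ∷ y ∷ []) B) ⟩
    (reverse B ++ y ∷ x ∷ []) ++ reverse A
      ≡⟨ ++-assoc (reverse B) _ _ ⟩
    reverse B ++ y ∷ x ∷ reverse A ∎

unique-adjacent : ∀ {l i x y j} → Unique l → Adjacent l i x y j → x ≢ y
unique-adjacent {l} u (A , B , refl , _) = go A u
  where
  go : ∀ A {x y} → Unique (A ++ x ∷ y ∷ B) → x ≢ y
  go [] ((ne ∷ _) ∷ _) = ne
  go (z ∷ A) (_ ∷ u) = go A u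

descents-reverse : ∀ k l → length l ≡ suc k →
  map (λ i → if isDes (reverse l) (suc k ∸ i) then D else U) (oneTo k) ≡ steps l
descents-reverse k (x ∷ l) refl = map-steps _ x l λ {i} {y} {z} {j} adj →
  cong (λ b → if b then D else U) (trans
    (cong (isDes (reverse (x ∷ l))) (begin
      k ∸ i           ≡⟨ cong (_∸ i) (suc-injective (adjacent-length adj)) ⟩
      suc (i + j) ∸ i ≡⟨ cong (_∸ i) (+-suc i j) ⟨
      i + suc j ∸ i   ≡⟨ m+n∸m≡n i (suc j) ⟩
      suc j           ∎))
    (adjacent-isDes (adjacent-reverse adj)))
  where open ≡-Reasoning

-- The test here is for a falling pair, that of `stepOf` for a rising one; they would differ on
-- equal neighbours.
descents : ∀ k l → Unique l → length l ≡ suc k →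
  map (λ i → if isDes l i then U else D) (oneTo k) ≡ steps l
descents k (x ∷ l) u refl = map-steps _ x l λ {_} {y} {z} adj →
  trans (cong (λ b → if b then U else D) (adjacent-isDes adj)) (swap y z (unique-adjacent u adj))
  where
  swap : ∀ y z → y ≢ z → (if z <ᵇ y then U else D) ≡ stepOf y z
  swap y z ne with <-cmp y z
  ... | tri< lt _ _ rewrite <ᵇ-true lt | <ᵇ-false (<⇒≤ lt) = refl
  ... | tri≈ _ e _ = ⊥-elim (ne e)
  ... | tri> _ _ gt rewrite <ᵇ-true gt | <ᵇ-false (<⇒≤ gt) = refl

pos-++ : ∀ v A B → All (_≢ v) A → pos v (A ++ v ∷ B) ≡ suc (length A)
pos-++ v [] B [] rewrite ≡ᵇ-refl v = refl
pos-++ v (x ∷ A) B (ne ∷ a) rewrite ≡ᵇ-false ne | pos-++ v A B a = refl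

pos-∈-++ : ∀ {v} A B → v ∈ A → pos v (A ++ B) ≡ pos v A
pos-∈-++ {v} A B m with split-∈ A m
... | L , R , refl , a = trans (cong (pos v) (++-assoc L (v ∷ R) B))
  (trans (pos-++ v L (R ++ B) a) (sym (pos-++ v L R a)))

map-run-reverse : ∀ f a p l → (∀ u → u < l → f (suc (u + a)) ≡ suc ((l ∸ suc u) + p)) →
  map f (run a l) ≡ reverse (run p l)
map-run-reverse f a p zero h = refl
map-run-reverse f a p (suc l) h = trans
  (cong₂ _∷_ (h 0 (s≤s z≤n)) (map-run-reverse f (suc a) p l λ u lt →
    trans (cong (f ∘ suc) (+-suc u a)) (h (suc u) (s≤s lt))))
  (sym (trans (cong reverse (run-∷ʳ p l)) (reverse-++ (run p l) _)))

-- The appended block occupies the positions `p + 1` to `p + u` and takes the same values. In it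
-- position plus value is always `2p + u + 1`, a condition symmetric in the two.
inv-block : ∀ p u A → A ↭ oneTo p → inv A ≡ A → inv (A ++ reverse (run p u)) ≡ A ++ reverse (run p u)
inv-block p u A perm e = begin
  map g (oneTo (length (A ++ B)))
    ≡⟨ cong (map g) (begin
      oneTo (length (A ++ B))  ≡⟨ cong oneTo (trans (length-++ A) (cong₂ _+_ len-A len-B)) ⟩
      oneTo (p + u)            ≡⟨ oneTo-run (p + u) ⟩
      run 0 (p + u)            ≡⟨ run-++ 0 p u ⟩
      run 0 p ++ run (p + 0) u ≡⟨ cong₂ (λ x y → x ++ run y u) (sym (oneTo-run p)) (+-identityʳ p) ⟩
      oneTo p ++ run p u       ∎) ⟩
  map g (oneTo p ++ run p u)
    ≡⟨ map-++ g (oneTo p) (run p u) ⟩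
  map g (oneTo p) ++ map g (run p u)
    ≡⟨ cong₂ _++_ old (map-run-reverse g p p u new) ⟩
  A ++ B ∎
  where
  open ≡-Reasoning
  B = reverse (run p u)
  g = λ j → pos j (A ++ B)
  len-A : length A ≡ p
  len-A = trans (↭-length perm) (length-oneTo p)
  len-B : length B ≡ u
  len-B = trans (length-reverse (run p u)) (length-run p u)
  old : map g (oneTo p) ≡ A
  old = begin
    map g (oneTo p)
      ≡⟨ map-cong-local (All.tabulate λ m → pos-∈-++ A B (∈-resp-↭ (↭-sym perm) m)) ⟩
    map (λ j → pos j A) (oneTo p)
      ≡⟨ cong (λ n → map (λ j → pos j A) (oneTo n)) len-A ⟨
    inv A
      ≡⟨ e ⟩
    A ∎
  new : ∀ v → v < u → g (suc (v + p)) ≡ suc ((u ∸ suc v) + p)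
  new v lt with run-split {p} v lt
  ... | k , refl , eq = begin
    pos x (A ++ B)
      ≡⟨ cong (λ z → pos x (A ++ z)) (begin
        reverse (run p u)
          ≡⟨ cong reverse (trans eq (sym (++-assoc (run p v) (x ∷ []) _))) ⟩
        reverse ((run p v ++ x ∷ []) ++ run x k)
          ≡⟨ reverse-++ (run p v ++ x ∷ []) (run x k) ⟩
        K ++ reverse (run p v ++ x ∷ [])
          ≡⟨ cong (K ++_) (reverse-++ (run p v) (x ∷ [])) ⟩
        K ++ x ∷ reverse (run p v) ∎) ⟩
    pos x (A ++ K ++ x ∷ reverse (run p v))
      ≡⟨ cong (pos x) (++-assoc A K _) ⟨
    pos x ((A ++ K) ++ x ∷ reverse (run p v))
      ≡⟨ pos-++ x (A ++ K) _ (++⁺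
           (All-resp-↭ (↭-sym perm) (All.map (λ le → <⇒≢ (s≤s (≤-trans le (m≤n+m p v)))) (oneTo-≤ p)))
           (All-resp-↭ (↭-sym (↭-reverse (run x k))) (All.map (λ lt e → <⇒≢ lt (sym e)) (run-> x k)))) ⟩
    suc (length (A ++ K))
      ≡⟨ cong suc (trans (length-++ A) (cong₂ _+_ len-A
           (trans (length-reverse (run x k)) (length-run x k)))) ⟩
    suc (p + k)
      ≡⟨ cong suc (+-comm p k) ⟩
    suc (k + p)
      ≡⟨ cong (λ z → suc (z + p)) (trans (cong (_∸ suc v) (+-suc v k)) (m+n∸m≡n v k)) ⟨
    suc ((u ∸ suc v) + p) ∎
    where
    x = suc (v + p)
    K = reverse (run x k)

inv-layered : ∀ t r → inv (reverse (layered t r)) ≡ reverse (layered t r)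
inv-layered t [] = inv-block 0 (suc t) [] ↭-refl refl
inv-layered t (D ∷ r) = inv-layered (suc t) r
inv-layered t (U ∷ r) = trans (cong inv e) (trans
  (inv-block p (suc t) (reverse (layered 0 r))
    (↭-trans (↭-reverse (layered 0 r)) (layered-↭ 0 r)) (inv-layered 0 r))
  (sym e))
  where
  p = suc (length r)
  e : reverse (run p (suc t) ++ layered 0 r) ≡ reverse (layered 0 r) ++ reverse (run p (suc t))
  e = reverse-++ (run p (suc t)) (layered 0 r)

DL-swd : ∀ k r → length r ≡ 2 * k → DL k (swd (reverse (extremal r))) ≡ (r , r)
DL-swd k r len rewrite swd-extremal r | inv-layered 0 r | reverse-involutive (layered 0 r) =
  cong₂ _,_ (trans (descents-reverse (2 * k) (layered 0 r) len′) (steps-layered 0 r))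
            (trans (descents (2 * k) (layered 0 r)
                     (unique-↭ (↭-sym (layered-↭ 0 r)) (oneTo-unique _)) len′) (steps-layered 0 r))
  where
  len′ : length (layered 0 r) ≡ suc (2 * k)
  len′ = trans (layered-length 0 r) (cong suc len)

-- Counting Dyck paths

-- Paths from height h to the axis with u rises.
paths : ℕ → ℕ → List (List Step)
paths zero zero = [] ∷ []
paths zero (suc h) = map (D ∷_) (paths zero h)
paths (suc u) zero = map (U ∷_) (paths u 1)
paths (suc u) (suc h) = map (U ∷_) (paths u (suc (suc h))) ++ map (D ∷_) (paths (suc u) h)

length-rise : ∀ u h {n} → n ≡ suc h + u * 2 → suc n ≡ h + suc u * 2
length-rise u h refl = sym (trans (+-suc h _) (cong suc (+-suc h _)))

paths-sound : ∀ u h {w} → w ∈ paths u h → Bal h w × length w ≡ h + u * 2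
paths-sound zero zero (here refl) = refl , refl
paths-sound zero (suc h) i with ∈-map⁻ (D ∷_) i
... | w , j , refl with paths-sound zero h j
...   | b , e = b , cong suc e
paths-sound (suc u) zero i with ∈-map⁻ (U ∷_) i
... | w , j , refl with paths-sound u 1 j
...   | b , e = b , length-rise u 0 e
paths-sound (suc u) (suc h) i with ∈-++⁻ (map (U ∷_) (paths u (suc (suc h)))) i
... | inj₁ i′ with ∈-map⁻ (U ∷_) i′
...   | w , j , refl with paths-sound u (suc (suc h)) j
...     | b , e = b , length-rise u (suc h) e
paths-sound (suc u) (suc h) i | inj₂ i′ with ∈-map⁻ (D ∷_) i′
...   | w , j , refl with paths-sound (suc u) h j
...     | b , e = b , cong suc e

bal-length : ∀ h w → Bal h w → h ≤ length w
bal-length h [] refl = z≤n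
bal-length h (U ∷ w) b = ≤-trans (n≤1+n h) (≤-trans (bal-length (suc h) w b) (n≤1+n _))
bal-length zero (D ∷ w) ()
bal-length (suc h) (D ∷ w) b = s≤s (bal-length h w b)

paths-complete : ∀ u h w → Bal h w → length w ≡ h + u * 2 → w ∈ paths u h
paths-complete zero zero [] b e = here refl
paths-complete zero h (U ∷ w) b e =
  ⊥-elim (<-irrefl (sym (trans e (+-identityʳ h)))
    (s≤s (≤-trans (n≤1+n h) (bal-length (suc h) w b))))
paths-complete zero (suc h) (D ∷ w) b e = ∈-map⁺ (D ∷_) (paths-complete zero h w b (suc-injective e))
paths-complete (suc u) zero (U ∷ w) b e = ∈-map⁺ (U ∷_) (paths-complete u 1 w b (suc-injective e))
paths-complete (suc u) (suc h) (U ∷ w) b e = ∈-++⁺ˡ (∈-map⁺ (U ∷_) (paths-complete u (suc (suc h)) w b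
  (suc-injective (trans e (sym (length-rise u (suc h) refl))))))
paths-complete (suc u) (suc h) (D ∷ w) b e =
  ∈-++⁺ʳ (map (U ∷_) (paths u (suc (suc h)))) (∈-map⁺ (D ∷_) (paths-complete (suc u) h w b (suc-injective e)))
paths-complete (suc u) h [] refl ()

paths-unique : ∀ u h → Unique (paths u h)
paths-unique zero zero = [] ∷ []
paths-unique zero (suc h) = Unique.map⁺ ∷-injectiveʳ (paths-unique zero h)
paths-unique (suc u) zero = Unique.map⁺ ∷-injectiveʳ (paths-unique u 1)
paths-unique (suc u) (suc h) = Unique.++⁺
  (Unique.map⁺ ∷-injectiveʳ (paths-unique u (suc (suc h))))
  (Unique.map⁺ ∷-injectiveʳ (paths-unique (suc u) h))
  λ (i , j) → disjoint (∈-map⁻ (U ∷_) i) (∈-map⁻ (D ∷_) j)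
  where
  disjoint : ∀ {w : List Step} {P Q : List Step → Set} →
    ∃[ v ] (P v × w ≡ U ∷ v) → ∃[ v ] (Q v × w ≡ D ∷ v) → ⊥
  disjoint (_ , _ , refl) (_ , _ , ())

-- Ballot numbers and binomial identities

infixl 6.5 _Cpred_
-- The binomial coefficient with lower index k - 1, which has to vanish for k = 0; truncated
-- subtraction would give 1 there.
_Cpred_ : ℕ → ℕ → ℕ
n Cpred zero = 0
n Cpred suc k = n C k

pascal : ∀ n k → suc n C k ≡ n Cpred k + n C k
pascal n zero = refl
pascal n (suc k) = sym (nCk+nC[k+1]≡[n+1]C[k+1] n k)

-- On the axis no fall is possible, so the recursion for `paths` lacks one summand of Pascal's rule;
-- the symmetry of an odd row makes up for it.
middle : ∀ u → (1 + u * 2) C u ≡ (1 + u * 2) C suc u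
middle u = trans (nCk≡nC[n∸k] (≤-trans (≤-trans (m≤m+n u (u + 0)) (≤-reflexive (*-comm 2 u))) (n≤1+n _)))
  (cong ((1 + u * 2) C_) (trans (cong (_∸ u) (begin
    1 + u * 2       ≡⟨ cong suc (*-comm u 2) ⟩
    1 + (u + (u + 0)) ≡⟨ cong (λ z → suc (u + z)) (+-identityʳ u) ⟩
    suc u + u       ∎)) (m+n∸n≡m (suc u) u)))
  where open ≡-Reasoning

-- The reflection principle: h + 2u steps of which u rise, minus those that cross the axis.
paths-count : ∀ u h → length (paths u h) + (h + u * 2) Cpred u ≡ (h + u * 2) C u
paths-count zero zero = refl
paths-count zero (suc h) = trans (cong (_+ 0) (length-map (D ∷_) (paths zero h))) (paths-count zero h)
paths-count (suc u) zero = begin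
  length (map (U ∷_) (paths u 1)) + suc n C u
    ≡⟨ cong₂ _+_ (length-map (U ∷_) (paths u 1)) (pascal n u) ⟩
  length (paths u 1) + (n Cpred u + n C u)
    ≡⟨ +-assoc (length (paths u 1)) _ _ ⟨
  length (paths u 1) + n Cpred u + n C u
    ≡⟨ cong₂ _+_ (paths-count u 1) (middle u) ⟩
  n C u + n C suc u
    ≡⟨ pascal n (suc u) ⟨
  suc n C suc u ∎
  where
  open ≡-Reasoning
  n = 1 + u * 2
paths-count (suc u) (suc h) = begin
  length (map (U ∷_) P ++ map (D ∷_) Q) + suc m C u
    ≡⟨ cong₂ _+_ (trans (length-++ (map (U ∷_) P)) (cong₂ _+_ (length-map (U ∷_) P) (length-map (D ∷_) Q)))
         (pascal m u) ⟩
  length P + length Q + (m Cpred u + m C u)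
    ≡⟨ rearrange (length P) (length Q) (m Cpred u) (m C u) ⟩
  (length P + m Cpred u) + (length Q + m C u)
    ≡⟨ cong₂ _+_ (subst (λ z → length P + z Cpred u ≡ z C u) (length-rise u h refl) (paths-count u (suc (suc h))))
         (paths-count (suc u) h) ⟩
  m C u + m C suc u
    ≡⟨ pascal m (suc u) ⟨
  suc m C suc u ∎
  where
  open ≡-Reasoning
  P = paths u (suc (suc h))
  Q = paths (suc u) h
  m = h + suc u * 2
  rearrange : ∀ p q a b → p + q + (a + b) ≡ (p + a) + (q + b)
  rearrange = solve-∀

-- This is (j + 1) C(n, j + 1) = (n - j) C(n, j) with the subtraction moved across, proved by
-- Pascal's rule.
absorption : ∀ n j → suc j * (n C suc j) + j * (n C j) ≡ n * (n C j)
absorption zero zero = refl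
absorption zero (suc j)
  rewrite k>n⇒nCk≡0 {0} {suc (suc j)} (s≤s z≤n) | k>n⇒nCk≡0 {0} {suc j} (s≤s z≤n)
        | *-zeroʳ j = refl
absorption (suc n) zero = trans (+-identityʳ _) (trans (*-identityˡ _)
  (trans (nC1≡n (suc n)) (sym (*-identityʳ (suc n)))))
absorption (suc n) (suc j) = begin
  suc (suc j) * (suc n C suc (suc j)) + suc j * (suc n C suc j)
    ≡⟨ cong₂ (λ x y → suc (suc j) * x + suc j * y) (pascal n (suc (suc j))) (pascal n (suc j)) ⟩
  suc (suc j) * (b + c) + suc j * (a + b)
    ≡⟨ regroup j a b c ⟩
  a + b + (suc j * b + j * a) + (suc (suc j) * c + suc j * b)
    ≡⟨ cong₂ (λ x y → a + b + x + y) (absorption n j) (absorption n (suc j)) ⟩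
  a + b + n * a + n * b
    ≡⟨ collect n a b ⟩
  suc n * (a + b)
    ≡⟨ cong (suc n *_) (pascal n (suc j)) ⟨
  suc n * (suc n C suc j) ∎
  where
  open ≡-Reasoning
  a = n C j
  b = n C suc j
  c = n C suc (suc j)
  regroup : ∀ j a b c → suc (suc j) * (b + c) + suc j * (a + b) ≡
    a + b + (suc j * b + j * a) + (suc (suc j) * c + suc j * b)
  regroup = solve-∀
  collect : ∀ n a b → a + b + n * a + n * b ≡ suc n * (a + b)
  collect = solve-∀

-- For k = j + 1 this is `absorption` in row 2k after cancelling j C(2k, j).
central-Cpred : ∀ k → suc k * ((2 * k) Cpred k) ≡ k * ((2 * k) C k)
central-Cpred zero = refl
central-Cpred (suc j) = +-cancelʳ-≡ (j * a) _ _ (sym (trans (absorption (2 * suc j) j) (double j a)))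
  where
  a = (2 * suc j) C j
  double : ∀ j a → 2 * suc j * a ≡ suc (suc j) * a + j * a
  double = solve-∀

paths-catalan : ∀ k → length (paths k 0) ≡ Catalan k
paths-catalan k = sym (trans (cong (_/ suc k) (sym product)) (m*n/n≡m N (suc k)))
  where
  open ≡-Reasoning
  N = length (paths k 0)
  c = (2 * k) C k
  product : N * suc k ≡ (2 * k) C k
  -- `N` is `c` minus its predecessor in the row, and k + 1 times that predecessor is `k * c`; so k
  -- + 1 times `N` is `c`, and the division is exact.
  product = +-cancelʳ-≡ (k * c) _ _ (begin
    N * suc k + k * c
      ≡⟨ cong₂ _+_ (*-comm N (suc k)) (sym (central-Cpred k)) ⟩
    suc k * N + suc k * ((2 * k) Cpred k)
      ≡⟨ *-distribˡ-+ (suc k) N _ ⟨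
    suc k * (N + (2 * k) Cpred k)
      ≡⟨ cong (suc k *_) (subst (λ z → N + z Cpred k ≡ z C k) (*-comm k 2) (paths-count k 0)) ⟩
    c + k * c ∎)

-- Dyck words as parameters: the bijection and the count

extremal-U132-312 : ∀ k r → IsDyck k r → U132-312 (suc (2 * k)) (reverse (extremal r))
extremal-U132-312 k r (len , bal) =
  perm , bal⇒uniquelySorted perm shape bal ,
  ¬firstBetween⇒avoids (reverse (extremal r)) (shape⇒¬firstBetween shape)
  where
  perm : IsPerm (suc (2 * k)) (reverse (extremal r))
  perm = ↭-trans (↭-reverse (extremal r)) (subst (λ n → extremal r ↭ oneTo (suc n)) len (extremal-↭ r))
  shape : Shape (reverse (reverse (extremal r))) r
  shape = subst (λ ρ → Shape ρ r) (sym (reverse-involutive (extremal r))) (extremal-shape r)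

avoiding-shape : ∀ n π → IsPerm (suc n) π → Avoids π (1 ∷ 3 ∷ 2 ∷ []) → Avoids π (3 ∷ 1 ∷ 2 ∷ []) →
  ∃[ r ] Shape (reverse π) r
avoiding-shape n π perm a b = go (reverse π)
  (↭-trans (↭-reverse π) perm)
  (avoids⇒¬firstBetween (reverse π)
    (subst (λ z → Avoids z (1 ∷ 3 ∷ 2 ∷ [])) (sym (reverse-involutive π)) a)
    (subst (λ z → Avoids z (3 ∷ 1 ∷ 2 ∷ [])) (sym (reverse-involutive π)) b))
  where
  go : ∀ ρ → ρ ↭ oneTo (suc n) → ¬ FirstBetween ρ → ∃[ r ] Shape ρ r
  go [] p nb with () ← ↭-length p
  go (x ∷ ρ) p nb = ¬firstBetween⇒shape x ρ (unique-↭ (↭-sym p) (oneTo-unique (suc n))) nb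

U132-312⇒extremal : ∀ k {π} → U132-312 (suc (2 * k)) π → ∃[ r ] (IsDyck k r × π ≡ reverse (extremal r))
U132-312⇒extremal k {π} (perm , us , a , b) with avoiding-shape (2 * k) π perm a b
... | r , shape = r , (len , uniquelySorted⇒bal perm shape us) ,
    trans (sym (reverse-involutive π)) (cong reverse (shape⇒extremal shape
      (↭-trans rperm (↭-reflexive (cong (oneTo ∘ suc) (sym len))))))
  where
  rperm : reverse π ↭ oneTo (suc (2 * k))
  rperm = ↭-trans (↭-reverse π) perm
  len : length r ≡ 2 * k
  len = suc-injective (trans (sym (shape-length shape)) (trans (↭-length rperm) (length-oneTo _)))

-- The word can be read off the list, since a head followed by further entries is not both above and
-- below them.
extremal-injective : ∀ {v w} → extremal v ≡ extremal w → v ≡ w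
extremal-injective {v} {w} e = shape-unique (extremal-shape v) (extremal-shape w) e
  where
  shape-unique : ∀ {ρ ρ′ v w} → Shape ρ v → Shape ρ′ w → ρ ≡ ρ′ → v ≡ w
  shape-unique single single _ = refl
  shape-unique single (up _ ()) refl
  shape-unique single (down _ ()) refl
  shape-unique (up _ s) (up _ t) refl = cong (U ∷_) (shape-unique s t refl)
  shape-unique (down _ s) (down _ t) refl = cong (D ∷_) (shape-unique s t refl)
  shape-unique (up _ ()) single refl
  shape-unique (down _ ()) single refl
  shape-unique (up {ρ = _ ∷ _} (p ∷ _) s) (down (q ∷ _) t) refl = ⊥-elim (<-asym p q)
  shape-unique (down {ρ = _ ∷ _} (p ∷ _) s) (up (q ∷ _) t) refl = ⊥-elim (<-asym p q)

theorem9p4 : (k : ℕ) →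
    ((π : List ℕ) → U132-312 (suc (2 * k)) π → InInt𝒜 k (DL k (swd π)))
    × ((π σ : List ℕ) → U132-312 (suc (2 * k)) π → U132-312 (suc (2 * k)) σ →
    DL k (swd π) ≡ DL k (swd σ) → π ≡ σ)
    × ((p : List Step × List Step) → InInt𝒜 k p →
    ∃[ π ] (U132-312 (suc (2 * k)) π × DL k (swd π) ≡ p))
    × (∃[ l ] (Unique l × ((π : List ℕ) → (π ∈ l ⇔ U132-312 (suc (2 * k)) π))
    × length l ≡ Catalan k))
theorem9p4 k = into , injective , surjective , perms ,
  Unique.map⁺ (extremal-injective ∘ reverse-injective) (paths-unique k 0) ,
  (λ π → mk⇔ (sound π) (complete π)) ,
  trans (length-map (reverse ∘ extremal) (paths k 0)) (paths-catalan k)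
  where
  perms = map (reverse ∘ extremal) (paths k 0)
  into : (π : List ℕ) → U132-312 (suc (2 * k)) π → InInt𝒜 k (DL k (swd π))
  into π u with U132-312⇒extremal k u
  ... | r , d , refl = subst (InInt𝒜 k) (sym (DL-swd k r (proj₁ d))) (d , d , refl)
  injective : (π σ : List ℕ) → U132-312 (suc (2 * k)) π → U132-312 (suc (2 * k)) σ →
    DL k (swd π) ≡ DL k (swd σ) → π ≡ σ
  injective π σ u u′ e with U132-312⇒extremal k u | U132-312⇒extremal k u′
  ... | r , d , refl | r′ , d′ , refl = cong (reverse ∘ extremal ∘ proj₁)
    (trans (sym (DL-swd k r (proj₁ d))) (trans e (DL-swd k r′ (proj₁ d′))))
  surjective : (p : List Step × List Step) → InInt𝒜 k p →
    ∃[ π ] (U132-312 (suc (2 * k)) π × DL k (swd π) ≡ p)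
  surjective (r , _) (d , _ , refl) =
    reverse (extremal r) , extremal-U132-312 k r d , DL-swd k r (proj₁ d)
  sound : ∀ π → π ∈ perms → U132-312 (suc (2 * k)) π
  sound π i with ∈-map⁻ (reverse ∘ extremal) i
  ... | r , j , refl with paths-sound k 0 j
  ...   | b , e = extremal-U132-312 k r (trans e (*-comm k 2) , b)
  complete : ∀ π → U132-312 (suc (2 * k)) π → π ∈ perms
  complete π u with U132-312⇒extremal k u
  ... | r , (len , b) , refl = ∈-map⁺ (reverse ∘ extremal)
    (paths-complete k 0 r b (trans len (*-comm 2 k)))
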